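{- Let $P, Q$ be nonzero real numbers with $\Delta := P^2 - 4Q > 0$, and let $(U_n)_{n\in\mathbb{Z}}$ and $\beta$ be as in the context. For any positive integer $r$, $$\sum_{n = 0}^{+\infty} \frac{\beta^{2^r n + 2^{r - 1}}}{U_{2^r n + 2^{r - 1}}} = \sum_{n = 1}^{+\infty} \frac{Q^{2^{r - 1} n}}{U_{2^r n}},$$ both series being convergent.
   Context: $P, Q$ are fixed nonzero real numbers with $\Delta := P^2 - 4Q > 0$. $\alpha$ and $\beta$ denote the two real roots of $X^2 - PX + Q = 0$, labelled so that $|\alpha| > |\beta|$ (the absolute values are distinct because $P \neq 0$ and $\Delta > 0$). The Lucas sequence of the first kind $(U_n)_{n \in \mathbb{Z}}$ is defined by $U_0 = 0$, $U_1 = 1$ and $U_{n+2} = P U_{n+1} - Q U_n$ for all $n \in \mathbb{Z}$; equivalently $U_n = \frac{\alpha^n - \beta^n}{\alpha - \beta}$. -}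

module Defs where

open import Algebra.Bundles.Raw using (RawRing)
import Algebra.Definitions.RawSemiring as RawSemiringDefs
open import Data.Integer as ℤ using (ℤ)
open import Data.Nat as ℕ using (ℕ; zero; suc)
import Data.Nat.Properties as ℕ
open import Data.Product using (∃; ∃-syntax; _×_; _,_; proj₁; proj₂)
open import Data.Rational as ℚ using (ℚ; 0ℚ; 1ℚ)
import Data.Rational.Properties as ℚ
open import Data.Rational.Solver using (module +-*-Solver)
open import Data.Fin using (toℕ)
open import Data.Sum using (_⊎_; inj₁; inj₂)
open import Level using (0ℓ)
open import Relation.Binary.PropositionalEquality
open import Relation.Nullary using (¬_; yes; no; contradiction)

open +-*-Solver using (solve; _:=_; _:+_; _:*_; :-_; _:-_)

------------------------------------------------------------------------
-- The real numbers are Cauchy sequences of rationals, with equality the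
-- relation "the difference tends to 0".

Cauchy : (ℕ → ℚ) → Set
Cauchy f = ∀ ε → 0ℚ ℚ.< ε →
  ∃[ N ] ∀ m n → N ℕ.≤ m → N ℕ.≤ n → ℚ.∣ f m ℚ.- f n ∣ ℚ.< ε

record ℝ : Set where
  constructor mkℝ
  field
    seq    : ℕ → ℚ
    cauchy : Cauchy seq

open ℝ public

infix 4 _≈_ _≉_ _<_ _#_

_≈_ : ℝ → ℝ → Set
x ≈ y = ∀ ε → 0ℚ ℚ.< ε →
  ∃[ N ] ∀ n → N ℕ.≤ n → ℚ.∣ seq x n ℚ.- seq y n ∣ ℚ.< ε

_≉_ : ℝ → ℝ → Set
x ≉ y = ¬ (x ≈ y)

_<_ : ℝ → ℝ → Set
x < y = ∃[ ε ] 0ℚ ℚ.< ε × ∃[ N ] ∀ n → N ℕ.≤ n → seq x n ℚ.+ ε ℚ.≤ seq y n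

-- Apartness is the positive form of x ≉ y; x # 0ℝ is what makes 1 / x
-- definable constructively.
_#_ : ℝ → ℝ → Set
x # y = x < y ⊎ y < x

module RationalLemmas where
  open ℚ.≤-Reasoning

  1/₊ : ∀ K → 0ℚ ℚ.< K → ∃[ L ] 0ℚ ℚ.< L × K ℚ.* L ≡ 1ℚ
  1/₊ K K>0 = L , ℚ.positive⁻¹ L {{ℚ.1/pos⇒pos K}} , ℚ.*-inverseʳ K
    where
    instance
      K⁺ : ℚ.Positive K
      K⁺ = ℚ.positive K>0
      K≢0 : ℚ.NonZero K
      K≢0 = ℚ.pos⇒nonZero K
    L = ℚ.1/ K

  *-pos : ∀ {p q} → 0ℚ ℚ.< p → 0ℚ ℚ.< q → 0ℚ ℚ.< p ℚ.* q
  *-pos {p} {q} p>0 q>0 =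
    ℚ.positive⁻¹ (p ℚ.* q) {{ℚ.pos*pos⇒pos p {{ℚ.positive p>0}} q {{ℚ.positive q>0}}}}

  +-pos : ∀ {p q} → 0ℚ ℚ.< p → 0ℚ ℚ.< q → 0ℚ ℚ.< p ℚ.+ q
  +-pos = ℚ.+-mono-<

  -- A sequence controlled by two Cauchy sequences is Cauchy.
  lipschitz : ∀ f g h → Cauchy f → Cauchy g → ∀ K N₀ → 0ℚ ℚ.< K →
    (∀ m n → N₀ ℕ.≤ m → N₀ ℕ.≤ n →
      ℚ.∣ h m ℚ.- h n ∣ ℚ.≤ K ℚ.* (ℚ.∣ f m ℚ.- f n ∣ ℚ.+ ℚ.∣ g m ℚ.- g n ∣)) →
    Cauchy h
  lipschitz f g h cf cg K N₀ K>0 bound ε ε>0 = N₀ ℕ.⊔ (N₁ ℕ.⊔ N₂) , close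
    where
    1/2K = 1/₊ (K ℚ.+ K) (+-pos K>0 K>0)
    L = proj₁ 1/2K
    L>0 = proj₁ (proj₂ 1/2K)
    2KL≡1 = proj₂ (proj₂ 1/2K)
    δ = L ℚ.* ε
    δ>0 = *-pos L>0 ε>0
    N₁ = proj₁ (cf δ δ>0)
    N₂ = proj₁ (cg δ δ>0)
    close : ∀ m n → N₀ ℕ.⊔ (N₁ ℕ.⊔ N₂) ℕ.≤ m → N₀ ℕ.⊔ (N₁ ℕ.⊔ N₂) ℕ.≤ n →
            ℚ.∣ h m ℚ.- h n ∣ ℚ.< ε
    close m n N≤m N≤n = begin-strict
      ℚ.∣ h m ℚ.- h n ∣
        ≤⟨ bound m n (ℕ.m⊔n≤o⇒m≤o N₀ _ N≤m) (ℕ.m⊔n≤o⇒m≤o N₀ _ N≤n) ⟩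
      K ℚ.* (ℚ.∣ f m ℚ.- f n ∣ ℚ.+ ℚ.∣ g m ℚ.- g n ∣)
        <⟨ ℚ.*-monoʳ-<-pos K {{ℚ.positive K>0}} (ℚ.+-mono-<
             (proj₂ (cf δ δ>0) m n (below₁ m N≤m) (below₁ n N≤n))
             (proj₂ (cg δ δ>0) m n (below₂ m N≤m) (below₂ n N≤n))) ⟩
      K ℚ.* (L ℚ.* ε ℚ.+ L ℚ.* ε)
        ≡⟨ solve 3 (λ k l e → k :* (l :* e :+ l :* e) := ((k :+ k) :* l) :* e) refl K L ε ⟩
      (K ℚ.+ K) ℚ.* L ℚ.* ε
        ≡⟨ cong (ℚ._* ε) 2KL≡1 ⟩
      1ℚ ℚ.* ε
        ≡⟨ ℚ.*-identityˡ ε ⟩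
      ε ∎
      where
      below₁ : ∀ k → N₀ ℕ.⊔ (N₁ ℕ.⊔ N₂) ℕ.≤ k → N₁ ℕ.≤ k
      below₁ k le = ℕ.m⊔n≤o⇒m≤o N₁ N₂ (ℕ.m⊔n≤o⇒n≤o N₀ _ le)
      below₂ : ∀ k → N₀ ℕ.⊔ (N₁ ℕ.⊔ N₂) ℕ.≤ k → N₂ ℕ.≤ k
      below₂ k le = ℕ.m⊔n≤o⇒n≤o N₁ N₂ (ℕ.m⊔n≤o⇒n≤o N₀ _ le)

  ∣p∣-∣q∣≤∣p-q∣ : ∀ p q → ℚ.∣ p ∣ ℚ.- ℚ.∣ q ∣ ℚ.≤ ℚ.∣ p ℚ.- q ∣
  ∣p∣-∣q∣≤∣p-q∣ p q = begin
    ℚ.∣ p ∣ ℚ.- ℚ.∣ q ∣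
      ≡⟨ cong (λ z → ℚ.∣ z ∣ ℚ.- ℚ.∣ q ∣) (solve 2 (λ a b → a := (a :- b) :+ b) refl p q) ⟩
    ℚ.∣ p ℚ.- q ℚ.+ q ∣ ℚ.- ℚ.∣ q ∣
      ≤⟨ ℚ.+-monoˡ-≤ (ℚ.- ℚ.∣ q ∣) (ℚ.∣p+q∣≤∣p∣+∣q∣ (p ℚ.- q) q) ⟩
    ℚ.∣ p ℚ.- q ∣ ℚ.+ ℚ.∣ q ∣ ℚ.- ℚ.∣ q ∣
      ≡⟨ solve 2 (λ a b → (a :+ b) :- b := a) refl ℚ.∣ p ℚ.- q ∣ ℚ.∣ q ∣ ⟩
    ℚ.∣ p ℚ.- q ∣ ∎

  ∣p-q∣≡∣q-p∣ : ∀ p q → ℚ.∣ p ℚ.- q ∣ ≡ ℚ.∣ q ℚ.- p ∣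
  ∣p-q∣≡∣q-p∣ p q = trans
    (cong ℚ.∣_∣ (solve 2 (λ a b → a :- b := :- (b :- a)) refl p q))
    (ℚ.∣-p∣≡∣p∣ (q ℚ.- p))

  ∣∣p∣-∣q∣∣≤∣p-q∣ : ∀ p q → ℚ.∣ ℚ.∣ p ∣ ℚ.- ℚ.∣ q ∣ ∣ ℚ.≤ ℚ.∣ p ℚ.- q ∣
  ∣∣p∣-∣q∣∣≤∣p-q∣ p q with ℚ.∣p∣≡p∨∣p∣≡-p (ℚ.∣ p ∣ ℚ.- ℚ.∣ q ∣)
  ... | inj₁ eq = ℚ.≤-trans (ℚ.≤-reflexive eq) (∣p∣-∣q∣≤∣p-q∣ p q)
  ... | inj₂ eq = begin
    ℚ.∣ ℚ.∣ p ∣ ℚ.- ℚ.∣ q ∣ ∣  ≡⟨ eq ⟩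
    ℚ.- (ℚ.∣ p ∣ ℚ.- ℚ.∣ q ∣)  ≡⟨ solve 2 (λ a b → :- (a :- b) := b :- a) refl ℚ.∣ p ∣ ℚ.∣ q ∣ ⟩
    ℚ.∣ q ∣ ℚ.- ℚ.∣ p ∣        ≤⟨ ∣p∣-∣q∣≤∣p-q∣ q p ⟩
    ℚ.∣ q ℚ.- p ∣              ≡⟨ ∣p-q∣≡∣q-p∣ q p ⟩
    ℚ.∣ p ℚ.- q ∣              ∎

  p≤p+q : ∀ p {q} → 0ℚ ℚ.≤ q → p ℚ.≤ p ℚ.+ q
  p≤p+q p q≥0 = ℚ.≤-trans (ℚ.≤-reflexive (sym (ℚ.+-identityʳ p))) (ℚ.+-monoʳ-≤ p q≥0)

  p≤q+p : ∀ p {q} → 0ℚ ℚ.≤ q → p ℚ.≤ q ℚ.+ p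
  p≤q+p p {q} q≥0 = ℚ.≤-trans (p≤p+q p q≥0) (ℚ.≤-reflexive (ℚ.+-comm p q))

  bounded : ∀ f → Cauchy f → ∃[ B ] 0ℚ ℚ.< B × ∃[ N ] ∀ n → N ℕ.≤ n → ℚ.∣ f n ∣ ℚ.≤ B
  bounded f cf with cf 1ℚ (ℚ.positive⁻¹ 1ℚ)
  ... | N , near = 1ℚ ℚ.+ ℚ.∣ f N ∣
                 , ℚ.<-≤-trans (ℚ.positive⁻¹ 1ℚ) (p≤p+q 1ℚ (ℚ.0≤∣p∣ (f N)))
                 , N , λ n N≤n → begin
    ℚ.∣ f n ∣
      ≡⟨ cong ℚ.∣_∣ (solve 2 (λ a b → a := (a :- b) :+ b) refl (f n) (f N)) ⟩
    ℚ.∣ f n ℚ.- f N ℚ.+ f N ∣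
      ≤⟨ ℚ.∣p+q∣≤∣p∣+∣q∣ (f n ℚ.- f N) (f N) ⟩
    ℚ.∣ f n ℚ.- f N ∣ ℚ.+ ℚ.∣ f N ∣
      ≤⟨ ℚ.+-monoˡ-≤ ℚ.∣ f N ∣ (ℚ.<⇒≤ (near n N N≤n ℕ.≤-refl)) ⟩
    1ℚ ℚ.+ ℚ.∣ f N ∣ ∎

  +-diff : ∀ a b c d → ℚ.∣ (a ℚ.+ b) ℚ.- (c ℚ.+ d) ∣ ℚ.≤ 1ℚ ℚ.* (ℚ.∣ a ℚ.- c ∣ ℚ.+ ℚ.∣ b ℚ.- d ∣)
  +-diff a b c d = begin
    ℚ.∣ (a ℚ.+ b) ℚ.- (c ℚ.+ d) ∣
      ≡⟨ cong ℚ.∣_∣ (solve 4 (λ a b c d → (a :+ b) :- (c :+ d) := (a :- c) :+ (b :- d)) refl a b c d) ⟩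
    ℚ.∣ (a ℚ.- c) ℚ.+ (b ℚ.- d) ∣
      ≤⟨ ℚ.∣p+q∣≤∣p∣+∣q∣ (a ℚ.- c) (b ℚ.- d) ⟩
    ℚ.∣ a ℚ.- c ∣ ℚ.+ ℚ.∣ b ℚ.- d ∣
      ≡⟨ ℚ.*-identityˡ _ ⟨
    1ℚ ℚ.* (ℚ.∣ a ℚ.- c ∣ ℚ.+ ℚ.∣ b ℚ.- d ∣) ∎

  *-diff : ∀ a b c d K → ℚ.∣ a ∣ ℚ.≤ K → ℚ.∣ d ∣ ℚ.≤ K →
    ℚ.∣ a ℚ.* b ℚ.- c ℚ.* d ∣ ℚ.≤ K ℚ.* (ℚ.∣ a ℚ.- c ∣ ℚ.+ ℚ.∣ b ℚ.- d ∣)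
  *-diff a b c d K a≤K d≤K = begin
    ℚ.∣ a ℚ.* b ℚ.- c ℚ.* d ∣
      ≡⟨ cong ℚ.∣_∣ (solve 4 (λ a b c d → a :* b :- c :* d := a :* (b :- d) :+ d :* (a :- c)) refl a b c d) ⟩
    ℚ.∣ a ℚ.* (b ℚ.- d) ℚ.+ d ℚ.* (a ℚ.- c) ∣
      ≤⟨ ℚ.∣p+q∣≤∣p∣+∣q∣ (a ℚ.* (b ℚ.- d)) (d ℚ.* (a ℚ.- c)) ⟩
    ℚ.∣ a ℚ.* (b ℚ.- d) ∣ ℚ.+ ℚ.∣ d ℚ.* (a ℚ.- c) ∣
      ≡⟨ cong₂ ℚ._+_ (ℚ.∣p*q∣≡∣p∣*∣q∣ a (b ℚ.- d)) (ℚ.∣p*q∣≡∣p∣*∣q∣ d (a ℚ.- c)) ⟩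
    ℚ.∣ a ∣ ℚ.* ℚ.∣ b ℚ.- d ∣ ℚ.+ ℚ.∣ d ∣ ℚ.* ℚ.∣ a ℚ.- c ∣
      ≤⟨ ℚ.+-mono-≤
           (ℚ.*-monoʳ-≤-nonNeg ℚ.∣ b ℚ.- d ∣ {{ℚ.∣-∣-nonNeg (b ℚ.- d)}} a≤K)
           (ℚ.*-monoʳ-≤-nonNeg ℚ.∣ a ℚ.- c ∣ {{ℚ.∣-∣-nonNeg (a ℚ.- c)}} d≤K) ⟩
    K ℚ.* ℚ.∣ b ℚ.- d ∣ ℚ.+ K ℚ.* ℚ.∣ a ℚ.- c ∣
      ≡⟨ solve 3 (λ k u v → k :* v :+ k :* u := k :* (u :+ v)) refl K ℚ.∣ a ℚ.- c ∣ ℚ.∣ b ℚ.- d ∣ ⟩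
    K ℚ.* (ℚ.∣ a ℚ.- c ∣ ℚ.+ ℚ.∣ b ℚ.- d ∣) ∎

  inverse-diff : ∀ a c a' c' L → a ℚ.* a' ≡ 1ℚ → c ℚ.* c' ≡ 1ℚ →
    ℚ.∣ a' ∣ ℚ.≤ L → ℚ.∣ c' ∣ ℚ.≤ L →
    ℚ.∣ a' ℚ.- c' ∣ ℚ.≤ L ℚ.* L ℚ.* (ℚ.∣ a ℚ.- c ∣ ℚ.+ ℚ.∣ a ℚ.- c ∣)
  inverse-diff a c a' c' L aa'≡1 cc'≡1 a'≤L c'≤L = begin
    ℚ.∣ a' ℚ.- c' ∣
      ≡⟨ cong ℚ.∣_∣ (cong₂ ℚ._-_
           (trans (sym (ℚ.*-identityʳ a')) (cong (a' ℚ.*_) (sym cc'≡1)))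
           (trans (sym (ℚ.*-identityʳ c')) (cong (c' ℚ.*_) (sym aa'≡1)))) ⟩
    ℚ.∣ a' ℚ.* (c ℚ.* c') ℚ.- c' ℚ.* (a ℚ.* a') ∣
      ≡⟨ cong ℚ.∣_∣ (solve 4 (λ a c a' c' →
           a' :* (c :* c') :- c' :* (a :* a') := (a' :* c') :* (c :- a)) refl a c a' c') ⟩
    ℚ.∣ (a' ℚ.* c') ℚ.* (c ℚ.- a) ∣
      ≡⟨ trans (ℚ.∣p*q∣≡∣p∣*∣q∣ (a' ℚ.* c') (c ℚ.- a))
           (cong₂ ℚ._*_ (ℚ.∣p*q∣≡∣p∣*∣q∣ a' c') (∣p-q∣≡∣q-p∣ c a)) ⟩
    (ℚ.∣ a' ∣ ℚ.* ℚ.∣ c' ∣) ℚ.* ℚ.∣ a ℚ.- c ∣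
      ≤⟨ ℚ.*-monoʳ-≤-nonNeg ℚ.∣ a ℚ.- c ∣ {{ℚ.∣-∣-nonNeg (a ℚ.- c)}} a'c'≤LL ⟩
    (L ℚ.* L) ℚ.* ℚ.∣ a ℚ.- c ∣
      ≤⟨ ℚ.*-monoˡ-≤-nonNeg (L ℚ.* L) {{ℚ.nonNegative 0≤LL}}
           (p≤p+q ℚ.∣ a ℚ.- c ∣ (ℚ.0≤∣p∣ (a ℚ.- c))) ⟩
    (L ℚ.* L) ℚ.* (ℚ.∣ a ℚ.- c ∣ ℚ.+ ℚ.∣ a ℚ.- c ∣) ∎
    where
    a'c'≤LL : ℚ.∣ a' ∣ ℚ.* ℚ.∣ c' ∣ ℚ.≤ L ℚ.* L
    a'c'≤LL = ℚ.≤-trans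
      (ℚ.*-monoʳ-≤-nonNeg ℚ.∣ c' ∣ {{ℚ.∣-∣-nonNeg c'}} a'≤L)
      (ℚ.*-monoˡ-≤-nonNeg L {{ℚ.nonNegative (ℚ.≤-trans (ℚ.0≤∣p∣ a') a'≤L)}} c'≤L)
    0≤LL : 0ℚ ℚ.≤ L ℚ.* L
    0≤LL = ℚ.≤-trans (ℚ.0≤∣p∣ (a' ℚ.* c'))
      (ℚ.≤-trans (ℚ.≤-reflexive (ℚ.∣p*q∣≡∣p∣*∣q∣ a' c')) a'c'≤LL)

  awayFrom0 : ∀ x y → (∀ n → seq y n ≡ 0ℚ) → x # y →
    ∃[ ε ] 0ℚ ℚ.< ε × ∃[ N ] ∀ n → N ℕ.≤ n → ε ℚ.≤ ℚ.∣ seq x n ∣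
  awayFrom0 x y y≡0 (inj₁ (ε , ε>0 , N , le)) = ε , ε>0 , N , λ n N≤n → begin
    ε                              ≡⟨ solve 2 (λ a e → e := (a :+ e) :- a) refl (seq x n) ε ⟩
    seq x n ℚ.+ ε ℚ.- seq x n      ≤⟨ ℚ.+-monoˡ-≤ (ℚ.- seq x n) (le n N≤n) ⟩
    seq y n ℚ.- seq x n            ≡⟨ cong (ℚ._- seq x n) (y≡0 n) ⟩
    0ℚ ℚ.- seq x n                 ≡⟨ ℚ.+-identityˡ (ℚ.- seq x n) ⟩
    ℚ.- seq x n                    ≤⟨ p≤∣p∣ (ℚ.- seq x n) ⟩
    ℚ.∣ ℚ.- seq x n ∣              ≡⟨ ℚ.∣-p∣≡∣p∣ (seq x n) ⟩
    ℚ.∣ seq x n ∣                  ∎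
    where
    p≤∣p∣ : ∀ p → p ℚ.≤ ℚ.∣ p ∣
    p≤∣p∣ p with ℚ.≤-total 0ℚ p
    ... | inj₁ 0≤p = ℚ.≤-reflexive (sym (ℚ.0≤p⇒∣p∣≡p 0≤p))
    ... | inj₂ p≤0 = ℚ.≤-trans p≤0 (ℚ.0≤∣p∣ p)
  awayFrom0 x y y≡0 (inj₂ (ε , ε>0 , N , le)) = ε , ε>0 , N , λ n N≤n →
    let ε≤x : ε ℚ.≤ seq x n
        ε≤x = begin
          ε                  ≡⟨ ℚ.+-identityˡ ε ⟨
          0ℚ ℚ.+ ε           ≡⟨ cong (ℚ._+ ε) (y≡0 n) ⟨
          seq y n ℚ.+ ε      ≤⟨ le n N≤n ⟩
          seq x n            ∎
    in ℚ.≤-trans ε≤x (ℚ.≤-reflexive (sym (ℚ.0≤p⇒∣p∣≡p (ℚ.≤-trans (ℚ.<⇒≤ ε>0) ε≤x))))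

open RationalLemmas

------------------------------------------------------------------------
-- Arithmetic: every operation acts termwise on representatives.

fromℚ : ℚ → ℝ
fromℚ q = mkℝ (λ _ → q) λ ε ε>0 → 0 , λ _ _ _ _ →
  ℚ.≤-<-trans (ℚ.≤-reflexive (cong ℚ.∣_∣ (ℚ.+-inverseʳ q))) ε>0

0ℝ 1ℝ 4ℝ : ℝ
0ℝ = fromℚ 0ℚ
1ℝ = fromℚ 1ℚ
4ℝ = fromℚ (ℤ.+ 4 ℚ./ 1)

abstract
  +-cauchy : ∀ x y → Cauchy (λ n → seq x n ℚ.+ seq y n)
  +-cauchy x y = lipschitz (seq x) (seq y) (λ n → seq x n ℚ.+ seq y n) (cauchy x) (cauchy y) 1ℚ 0 (ℚ.positive⁻¹ 1ℚ) λ m n _ _ →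
    +-diff (seq x m) (seq y m) (seq x n) (seq y n)

  -‿cauchy : ∀ x → Cauchy (λ n → ℚ.- seq x n)
  -‿cauchy x ε ε>0 = let N , near = cauchy x ε ε>0 in N , λ m n N≤m N≤n → ℚ.≤-<-trans
    (ℚ.≤-reflexive (trans
      (cong ℚ.∣_∣ (solve 2 (λ a b → :- a :- :- b := b :- a) refl (seq x m) (seq x n)))
      (∣p-q∣≡∣q-p∣ (seq x n) (seq x m))))
    (near m n N≤m N≤n)

  *-cauchy : ∀ x y → Cauchy (λ n → seq x n ℚ.* seq y n)
  *-cauchy x y =
    let A , A>0 , N₁ , x≤A = bounded (seq x) (cauchy x)
        B , B>0 , N₂ , y≤B = bounded (seq y) (cauchy y)
    in lipschitz (seq x) (seq y) (λ n → seq x n ℚ.* seq y n) (cauchy x) (cauchy y) (A ℚ.+ B) (N₁ ℕ.⊔ N₂) (+-pos A>0 B>0) λ m n N≤m N≤n →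
      *-diff (seq x m) (seq y m) (seq x n) (seq y n) (A ℚ.+ B)
        (ℚ.≤-trans (x≤A m (ℕ.m⊔n≤o⇒m≤o N₁ N₂ N≤m)) (p≤p+q A (ℚ.<⇒≤ B>0)))
        (ℚ.≤-trans (y≤B n (ℕ.m⊔n≤o⇒n≤o N₁ N₂ N≤n)) (p≤q+p B (ℚ.<⇒≤ A>0)))

  ∣-∣-cauchy : ∀ x → Cauchy (λ n → ℚ.∣ seq x n ∣)
  ∣-∣-cauchy x ε ε>0 = let N , near = cauchy x ε ε>0 in N , λ m n N≤m N≤n →
    ℚ.≤-<-trans (∣∣p∣-∣q∣∣≤∣p-q∣ (seq x m) (seq x n)) (near m n N≤m N≤n)

infix  8 -_
infixl 7 _*_
infixl 6 _+_ _-_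

_+_ : ℝ → ℝ → ℝ
x + y = mkℝ (λ n → seq x n ℚ.+ seq y n) (+-cauchy x y)

-_ : ℝ → ℝ
- x = mkℝ (λ n → ℚ.- seq x n) (-‿cauchy x)

_-_ : ℝ → ℝ → ℝ
x - y = x + (- y)

_*_ : ℝ → ℝ → ℝ
x * y = mkℝ (λ n → seq x n ℚ.* seq y n) (*-cauchy x y)

∣_∣ : ℝ → ℝ
∣ x ∣ = mkℝ (λ n → ℚ.∣ seq x n ∣) (∣-∣-cauchy x)

-- The value at 0 is immaterial: a representative of a real apart from 0
-- is eventually nonzero.
recip : ℚ → ℚ
recip q with q ℚ.≟ 0ℚ
... | yes _  = 0ℚ
... | no q≢0 = ℚ.1/_ q {{ℚ.≢-nonZero q≢0}}

recip-large : ∀ ε L → 0ℚ ℚ.< ε → 0ℚ ℚ.< L → ε ℚ.* L ≡ 1ℚ →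
  ∀ a → ε ℚ.≤ ℚ.∣ a ∣ → a ℚ.* recip a ≡ 1ℚ × ℚ.∣ recip a ∣ ℚ.≤ L
recip-large ε L ε>0 L>0 εL≡1 a ε≤∣a∣ with a ℚ.≟ 0ℚ
... | yes refl = contradiction (ℚ.<-≤-trans ε>0 ε≤∣a∣) (ℚ.<-irrefl refl)
... | no a≢0   = inverse , (begin
  ℚ.∣ a' ∣                          ≡⟨ ℚ.*-identityˡ ℚ.∣ a' ∣ ⟨
  1ℚ ℚ.* ℚ.∣ a' ∣                   ≡⟨ cong (ℚ._* ℚ.∣ a' ∣) εL≡1 ⟨
  (ε ℚ.* L) ℚ.* ℚ.∣ a' ∣
    ≤⟨ ℚ.*-monoʳ-≤-nonNeg ℚ.∣ a' ∣ {{ℚ.∣-∣-nonNeg a'}} εL≤∣a∣L ⟩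
  (ℚ.∣ a ∣ ℚ.* L) ℚ.* ℚ.∣ a' ∣
    ≡⟨ solve 3 (λ a l b → (a :* l) :* b := l :* (a :* b)) refl ℚ.∣ a ∣ L ℚ.∣ a' ∣ ⟩
  L ℚ.* (ℚ.∣ a ∣ ℚ.* ℚ.∣ a' ∣)
    ≡⟨ cong (L ℚ.*_) (trans (sym (ℚ.∣p*q∣≡∣p∣*∣q∣ a a')) (cong ℚ.∣_∣ inverse)) ⟩
  L ℚ.* 1ℚ                          ≡⟨ ℚ.*-identityʳ L ⟩
  L ∎)
  where
  open ℚ.≤-Reasoning
  a' = ℚ.1/_ a {{ℚ.≢-nonZero a≢0}}
  inverse : a ℚ.* a' ≡ 1ℚ
  inverse = ℚ.*-inverseʳ a {{ℚ.≢-nonZero a≢0}}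
  εL≤∣a∣L : ε ℚ.* L ℚ.≤ ℚ.∣ a ∣ ℚ.* L
  εL≤∣a∣L = ℚ.*-monoʳ-≤-nonNeg L {{ℚ.nonNegative (ℚ.<⇒≤ L>0)}} ε≤∣a∣

abstract
  recip-cauchy : ∀ x → x # 0ℝ → Cauchy (λ n → recip (seq x n))
  recip-cauchy x x#0 =
    let ε , ε>0 , N , ε≤∣x∣ = awayFrom0 x 0ℝ (λ _ → refl) x#0
        L , L>0 , εL≡1 = 1/₊ ε ε>0
    in lipschitz (seq x) (seq x) (λ n → recip (seq x n)) (cauchy x) (cauchy x) (L ℚ.* L) N (*-pos L>0 L>0) λ m n N≤m N≤n →
      let aa'≡1 , a'≤L = recip-large ε L ε>0 L>0 εL≡1 (seq x m) (ε≤∣x∣ m N≤m)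
          cc'≡1 , c'≤L = recip-large ε L ε>0 L>0 εL≡1 (seq x n) (ε≤∣x∣ n N≤n)
      in inverse-diff (seq x m) (seq x n) (recip (seq x m)) (recip (seq x n)) L aa'≡1 cc'≡1 a'≤L c'≤L

infixl 7 _/_[_]

_/_[_] : ∀ (x y : ℝ) → y # 0ℝ → ℝ
x / y [ y#0 ] = x * mkℝ (λ n → recip (seq y n)) (recip-cauchy y y#0)

ℝ-rawRing : RawRing 0ℓ 0ℓ
ℝ-rawRing = record
  { _≈_ = _≈_ ; _+_ = _+_ ; _*_ = _*_ ; -_ = -_ ; 0# = 0ℝ ; 1# = 1ℝ }

open RawSemiringDefs (RawRing.rawSemiring ℝ-rawRing) public using (_^_; sum)

------------------------------------------------------------------------
-- Limits and series

ConvergesTo : (ℕ → ℝ) → ℝ → Set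
ConvergesTo s L = ∀ ε → 0ℝ < ε → ∃[ N ] ∀ n → N ℕ.≤ n → ∣ s n - L ∣ < ε

-- Series are indexed from 0; a series starting at 1 is given by n ↦ t (suc n).
HasSum : (ℕ → ℝ) → ℝ → Set
HasSum t S = ConvergesTo (λ N → sum {N} (λ i → t (toℕ i))) S

------------------------------------------------------------------------
-- Lucas sequences

IsRoot : (P Q x : ℝ) → Set
IsRoot P Q x = x ^ 2 - P * x + Q ≈ 0ℝ

record IsLucasSequence (P Q : ℝ) (U : ℤ → ℝ) : Set where
  field
    U₀         : U (ℤ.+ 0) ≈ 0ℝ
    U₁         : U (ℤ.+ 1) ≈ 1ℝ
    recurrence : ∀ n → U (n ℤ.+ ℤ.+ 2) ≈ P * U (n ℤ.+ ℤ.+ 1) - Q * U n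

{-# OPTIONS --safe #-}

-- Put x = β/α, so that |x| < 1, and y = x^(2^(r-1)).  By Binet's formula
-- (α - β) Uₙ = αⁿ (1 - xⁿ) and by Q = αβ, the two series have the terms
-- (α - β) y^(2n+1) / (1 - y^(2n+1)) and (α - β) y^(n+1) / (1 - y^(2n+2)), n ≥ 0,
-- and both sum to (α - β) times the sum of y^((2n+1)k) over n ≥ 0, k ≥ 1.
-- Quantitatively, if |y| ≤ ρ < 1 then expanding each of the first N quotients to N
-- terms of its geometric series shows that the N-th partial sums differ by O(ρ^N).
-- These estimates hold for rational y, hence at every large index of representatives
-- of the reals involved; being uniform in the index, they make the diagonal sequence
-- of the partial sums a representative of the common sum.

module Submission where

open import Algebra.Bundles using (CommutativeRing)
open import Data.Fin using (toℕ)
open import Data.Integer as ℤ using (ℤ)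
import Data.Integer.Properties as ℤ
open import Data.Integer.Solver using () renaming (module +-*-Solver to ℤ-Solver)
open import Data.Nat as ℕ using (ℕ; zero; suc; NonZero; pred)
import Data.Nat.Properties as ℕ
open import Data.Nat.Solver using () renaming (module +-*-Solver to ℕ-Solver)
open import Data.Product using (∃; ∃-syntax; _×_; _,_; Σ-syntax; proj₁; proj₂)
open import Data.Rational as ℚ using (ℚ; 0ℚ; 1ℚ; ½)
import Data.Rational.Properties as ℚ
open import Data.Rational.Solver using (module +-*-Solver)
import Data.Rational.Unnormalised as ℚᵘ
import Data.Rational.Unnormalised.Properties as ℚᵘ
open import Data.Sum using (inj₁; inj₂; [_,_]′)
open import Function using (_∘_)
open import Level using (0ℓ)
open import Relation.Binary.PropositionalEquality
  using (_≡_; _≢_; refl; sym; trans; cong; cong₂; subst₂)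
import Relation.Binary.Reasoning.Setoid as SetoidReasoning
open import Relation.Nullary using (yes; no; contradiction)
open +-*-Solver using (solve; con; _:=_; _:+_; _:*_; :-_; _:-_)

-- Powers, absolute values and inequalities over the rationals

module ℚ^ where
  open CommutativeRing ℚ.+-*-commutativeRing using (commutativeSemiring)
  open import Algebra.Properties.CommutativeSemiring.Exp commutativeSemiring public

module RationalEstimates where

  open import Data.Rational using (_+_; _*_; _-_; -_; _≤_; _<_; ∣_∣; ↥_; toℚᵘ; nonNegative)
  open import Data.Rational.Properties
  open CommutativeRing +-*-commutativeRing using (semiring)
  open import Algebra.Properties.Semiring.Mult semiring using () renaming (_×_ to _·_)
  open import Algebra.Properties.Semiring.Sum semiring
  open import Defs using (module RationalLemmas)
  open RationalLemmas
  open ℚ^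
  open ≤-Reasoning

  partialSum : (ℕ → ℚ) → ℕ → ℚ
  partialSum f n = sum {n} (f ∘ toℕ)

  p≤∣p∣ : ∀ p → p ≤ ∣ p ∣
  p≤∣p∣ p with ≤-total 0ℚ p
  ... | inj₁ 0≤p = ≤-reflexive (sym (0≤p⇒∣p∣≡p 0≤p))
  ... | inj₂ p≤0 = ≤-trans p≤0 (0≤∣p∣ p)

  *-nonNeg : ∀ {p q} → 0ℚ ≤ p → 0ℚ ≤ q → 0ℚ ≤ p * q
  *-nonNeg {p} {q} 0≤p 0≤q = nonNegative⁻¹ (p * q)
    {{nonNeg*nonNeg⇒nonNeg p {{nonNegative 0≤p}} q {{nonNegative 0≤q}}}}

  *-mono-≤ : ∀ {p q r s} → 0ℚ ≤ r → 0ℚ ≤ q → p ≤ q → r ≤ s → p * r ≤ q * s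
  *-mono-≤ {q = q} {r} 0≤r 0≤q p≤q r≤s = ≤-trans
    (*-monoʳ-≤-nonNeg r {{nonNegative 0≤r}} p≤q)
    (*-monoˡ-≤-nonNeg q {{nonNegative 0≤q}} r≤s)

  ∣*∣-mono-≤ : ∀ p q {r s} → ∣ p ∣ ≤ r → ∣ q ∣ ≤ s → ∣ p * q ∣ ≤ r * s
  ∣*∣-mono-≤ p q p≤r q≤s = ≤-trans (≤-reflexive (∣p*q∣≡∣p∣*∣q∣ p q))
    (*-mono-≤ (0≤∣p∣ q) (≤-trans (0≤∣p∣ p) p≤r) p≤r q≤s)

  ∣+∣-mono-≤ : ∀ p q {r s} → ∣ p ∣ ≤ r → ∣ q ∣ ≤ s → ∣ p + q ∣ ≤ r + s
  ∣+∣-mono-≤ p q p≤r q≤s = ≤-trans (∣p+q∣≤∣p∣+∣q∣ p q) (+-mono-≤ p≤r q≤s)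

  ∣-∣-mono-≤ : ∀ p q {r s} → ∣ p ∣ ≤ r → ∣ q ∣ ≤ s → ∣ p - q ∣ ≤ r + s
  ∣-∣-mono-≤ p q p≤r q≤s = ≤-trans (∣p-q∣≤∣p∣+∣q∣ p q) (+-mono-≤ p≤r q≤s)

  p≤q⇒0≤q-p : ∀ {p q} → p ≤ q → 0ℚ ≤ q - p
  p≤q⇒0≤q-p {p} p≤q = ≤-trans (≤-reflexive (sym (+-inverseʳ p))) (+-monoˡ-≤ (- p) p≤q)

  p<q⇒0<q-p : ∀ {p q} → p < q → 0ℚ < q - p
  p<q⇒0<q-p {p} p<q = ≤-<-trans (≤-reflexive (sym (+-inverseʳ p))) (+-monoˡ-< (- p) p<q)

  0≤q-p⇒p≤q : ∀ {p q} → 0ℚ ≤ q - p → p ≤ q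
  0≤q-p⇒p≤q {p} {q} 0≤q-p = begin
    p            ≡⟨ +-identityʳ p ⟨
    p + 0ℚ       ≤⟨ +-monoʳ-≤ p 0≤q-p ⟩
    p + (q - p)  ≡⟨ solve 2 (λ p q → p :+ (q :- p) := q) refl p q ⟩
    q            ∎

  ∣x∣≤ρ⇒∣x^n∣≤ρ^n : ∀ x {ρ} → ∣ x ∣ ≤ ρ → ∀ n → ∣ x ^ n ∣ ≤ ρ ^ n
  ∣x∣≤ρ⇒∣x^n∣≤ρ^n x x≤ρ zero    = ≤-refl
  ∣x∣≤ρ⇒∣x^n∣≤ρ^n x x≤ρ (suc n) = ∣*∣-mono-≤ x (x ^ n) x≤ρ (∣x∣≤ρ⇒∣x^n∣≤ρ^n x x≤ρ n)

  -- The absolute value of the numerator is large enough, since the denominator is at least 1. The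
  -- bound is a multiple of `1ℚ` so that `bernoulli` can recurse on it.
  archimedean : ∀ p → ∃[ n ] p ≤ n · 1ℚ
  archimedean p@record{} = ℤ.∣ ↥ p ∣ , ≤-trans (p≤∣p∣ p) (toℚᵘ-cancel-≤ (ℚᵘ.≤-trans
    (ℚᵘ.*≤* (ℤ.*-monoˡ-≤-nonNeg (ℤ.+ ℤ.∣ ↥ p ∣) (ℤ.+≤+ (ℕ.s≤s ℕ.z≤n))))
    (ℚᵘ.≤-reflexive (ℚᵘ.≃-sym (toℚᵘ-· ℤ.∣ ↥ p ∣)))))
    where
    toℚᵘ-· : ∀ n → toℚᵘ (n · 1ℚ) ℚᵘ.≃ ℚᵘ.mkℚᵘ (ℤ.+ n) 0
    toℚᵘ-· zero    = ℚᵘ.≃-refl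
    toℚᵘ-· (suc n) = ℚᵘ.≃-trans (toℚᵘ-homo-+ 1ℚ (n · 1ℚ)) (ℚᵘ.≃-trans
      (ℚᵘ.+-congʳ (toℚᵘ 1ℚ) (toℚᵘ-· n))
      (ℚᵘ.*≡* (ℤ-Solver.solve 1 (λ k → (one ℤ-Solver.:* one ℤ-Solver.:+ k ℤ-Solver.:* one) ℤ-Solver.:* one
         ℤ-Solver.:= (one ℤ-Solver.:+ k) ℤ-Solver.:* (one ℤ-Solver.:* one)) refl (ℤ.+ n))))
      where
      one : ∀ {m} → ℤ-Solver.Polynomial m
      one = ℤ-Solver.con (ℤ.+ 1)

  -- Finite geometric sums

  geometric-sum : ∀ z n → (1ℚ - z) * partialSum (z ^_) n ≡ 1ℚ - z ^ n
  geometric-sum z zero    = solve 1 (λ z → (con 1ℚ :- z) :* con 0ℚ := con 1ℚ :- con 1ℚ) refl z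
  geometric-sum z (suc n) = begin-equality
    (1ℚ - z) * (1ℚ + partialSum (λ i → z * z ^ i) n)
      ≡⟨ cong (λ s → (1ℚ - z) * (1ℚ + s)) (*-distribˡ-sum {n} z ((z ^_) ∘ toℕ)) ⟨
    (1ℚ - z) * (1ℚ + z * partialSum (z ^_) n)
      ≡⟨ solve 2 (λ z s → (con 1ℚ :- z) :* (con 1ℚ :+ z :* s)
                       := con 1ℚ :- z :+ z :* ((con 1ℚ :- z) :* s)) refl z (partialSum (z ^_) n) ⟩
    1ℚ - z + z * ((1ℚ - z) * partialSum (z ^_) n)
      ≡⟨ cong (λ s → 1ℚ - z + z * s) (geometric-sum z n) ⟩
    1ℚ - z + z * (1ℚ - z ^ n)
      ≡⟨ solve 2 (λ z p → con 1ℚ :- z :+ z :* (con 1ℚ :- p) := con 1ℚ :- z :* p) refl z (z ^ n) ⟩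
    1ℚ - z ^ suc n ∎

  -- The expansion of v / (1 - z) with exact remainder, free of division: the quotient enters only
  -- through its defining equation.
  geometric-expansion : ∀ {u z v} → u * (1ℚ - z) ≡ v → ∀ n →
    u ≡ partialSum (λ j → v * z ^ j) n + z ^ n * u
  geometric-expansion {u} {z} {v} eq n = begin-equality
    u
      ≡⟨ solve 2 (λ u p → u := u :* (con 1ℚ :- p) :+ p :* u) refl u (z ^ n) ⟩
    u * (1ℚ - z ^ n) + z ^ n * u
      ≡⟨ cong (λ s → u * s + z ^ n * u) (geometric-sum z n) ⟨
    u * ((1ℚ - z) * partialSum (z ^_) n) + z ^ n * u
      ≡⟨ cong (_+ z ^ n * u) (*-assoc u (1ℚ - z) _) ⟨
    u * (1ℚ - z) * partialSum (z ^_) n + z ^ n * u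
      ≡⟨ cong (λ s → s * partialSum (z ^_) n + z ^ n * u) eq ⟩
    v * partialSum (z ^_) n + z ^ n * u
      ≡⟨ cong (_+ z ^ n * u) (*-distribˡ-sum {n} v ((z ^_) ∘ toℕ)) ⟩
    partialSum (λ j → v * z ^ j) n + z ^ n * u ∎

  -- Geometric estimates with a fixed ratio ρ < 1

  module GeometricBounds (ρ σ : ℚ) (0≤ρ : 0ℚ ≤ ρ) (ρ<1 : ρ < 1ℚ) (σ-inverse : (1ℚ - ρ) * σ ≡ 1ℚ) (0<σ : 0ℚ < σ) where

    0≤σ : 0ℚ ≤ σ
    0≤σ = <⇒≤ 0<σ

    0≤ρ^ : ∀ n → 0ℚ ≤ ρ ^ n
    0≤ρ^ zero    = <⇒≤ (positive⁻¹ 1ℚ)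
    0≤ρ^ (suc n) = *-nonNeg 0≤ρ (0≤ρ^ n)

    ρ^suc≤ρ^ : ∀ n → ρ * ρ ^ n ≤ ρ ^ n
    ρ^suc≤ρ^ n = ≤-trans
      (*-monoʳ-≤-nonNeg (ρ ^ n) {{nonNegative (0≤ρ^ n)}} (<⇒≤ ρ<1))
      (≤-reflexive (*-identityˡ (ρ ^ n)))

    ρ^-antimono : ∀ {m n} → m ℕ.≤ n → ρ ^ n ≤ ρ ^ m
    ρ^-antimono {n = zero}  ℕ.z≤n       = ≤-refl
    ρ^-antimono {n = suc n} ℕ.z≤n       = ≤-trans (ρ^suc≤ρ^ n) (ρ^-antimono {n = n} ℕ.z≤n)
    ρ^-antimono             (ℕ.s≤s m≤n) = *-monoˡ-≤-nonNeg ρ {{nonNegative 0≤ρ}} (ρ^-antimono m≤n)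

    ρ^1+n≤ρ : ∀ n → ρ ^ suc n ≤ ρ
    ρ^1+n≤ρ n = ≤-trans (ρ^-antimono (ℕ.s≤s (ℕ.z≤n {n}))) (≤-reflexive (*-identityʳ ρ))

    -- With h = 1 - ρ, passing from n to n + 1 lowers the left side by exactly ρⁿ h (h + n h), which
    -- is nonnegative.
    bernoulli : ∀ n → ρ ^ n * (1ℚ + n · 1ℚ * (1ℚ - ρ)) ≤ 1ℚ
    bernoulli zero    = ≤-reflexive
      (solve 1 (λ r → con 1ℚ :* (con 1ℚ :+ con 0ℚ :* (con 1ℚ :- r)) := con 1ℚ) refl ρ)
    bernoulli (suc n) = ≤-trans (0≤q-p⇒p≤q (begin
      0ℚ
        ≤⟨ *-nonNeg (0≤ρ^ n) (*-nonNeg (p≤q⇒0≤q-p (<⇒≤ ρ<1)) (+-mono-≤ {x = 0ℚ} {u = 0ℚ}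
             (p≤q⇒0≤q-p (<⇒≤ ρ<1)) (*-nonNeg (0≤·1 n) (p≤q⇒0≤q-p (<⇒≤ ρ<1))))) ⟩
      ρ ^ n * ((1ℚ - ρ) * ((1ℚ - ρ) + n · 1ℚ * (1ℚ - ρ)))
        ≡⟨ solve 3 (λ r k p → p :* ((con 1ℚ :- r) :* ((con 1ℚ :- r) :+ k :* (con 1ℚ :- r)))
             := p :* (con 1ℚ :+ k :* (con 1ℚ :- r))
                :- r :* p :* (con 1ℚ :+ (con 1ℚ :+ k) :* (con 1ℚ :- r))) refl ρ (n · 1ℚ) (ρ ^ n) ⟩
      ρ ^ n * (1ℚ + n · 1ℚ * (1ℚ - ρ)) - ρ ^ suc n * (1ℚ + suc n · 1ℚ * (1ℚ - ρ)) ∎))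
      (bernoulli n)
      where
      0≤·1 : ∀ n → 0ℚ ≤ n · 1ℚ
      0≤·1 zero    = ≤-refl
      0≤·1 (suc n) = +-mono-≤ {x = 0ℚ} {u = 0ℚ} (<⇒≤ (positive⁻¹ 1ℚ)) (0≤·1 n)

    Kρ^-null : ∀ K → 0ℚ ≤ K → ∀ ε → 0ℚ < ε → ∃[ N ] ∀ n → N ℕ.≤ n → K * ρ ^ n ≤ ε
    Kρ^-null K 0≤K ε 0<ε =
      let η , 0<η , εη≡1 = 1/₊ ε 0<ε
          -- This is N ≥ K / ((1 - ρ) ε), so that K ≤ ε N (1 - ρ) and Bernoulli's inequality absorbs
          -- the factor N (1 - ρ).
          N , Kση≤N = archimedean (K * σ * η)
      in N , λ n N≤n → begin
        K * ρ ^ n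
          ≤⟨ *-monoˡ-≤-nonNeg K {{nonNegative 0≤K}} (ρ^-antimono N≤n) ⟩
        K * ρ ^ N
          ≡⟨ solve 2 (λ k p → k :* p := k :* con 1ℚ :* con 1ℚ :* p) refl K (ρ ^ N) ⟩
        K * 1ℚ * 1ℚ * ρ ^ N
          ≡⟨ cong₂ (λ a b → K * a * b * ρ ^ N) (sym σ-inverse) (sym εη≡1) ⟩
        K * ((1ℚ - ρ) * σ) * (ε * η) * ρ ^ N
          ≡⟨ solve 6 (λ k r s e h p → k :* ((con 1ℚ :- r) :* s) :* (e :* h) :* p
               := e :* (p :* (k :* s :* h :* (con 1ℚ :- r)))) refl K ρ σ ε η (ρ ^ N) ⟩
        ε * (ρ ^ N * (K * σ * η * (1ℚ - ρ)))
          ≤⟨ *-monoˡ-≤-nonNeg ε {{nonNegative (<⇒≤ 0<ε)}}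
               (*-monoˡ-≤-nonNeg (ρ ^ N) {{nonNegative (0≤ρ^ N)}}
                 (*-monoʳ-≤-nonNeg (1ℚ - ρ) {{nonNegative (p≤q⇒0≤q-p (<⇒≤ ρ<1))}} Kση≤N)) ⟩
        ε * (ρ ^ N * (N · 1ℚ * (1ℚ - ρ)))
          ≤⟨ *-monoˡ-≤-nonNeg ε {{nonNegative (<⇒≤ 0<ε)}}
               (*-monoˡ-≤-nonNeg (ρ ^ N) {{nonNegative (0≤ρ^ N)}}
                 (p≤q+p (N · 1ℚ * (1ℚ - ρ)) (<⇒≤ (positive⁻¹ 1ℚ)))) ⟩
        ε * (ρ ^ N * (1ℚ + N · 1ℚ * (1ℚ - ρ)))
          ≤⟨ *-monoˡ-≤-nonNeg ε {{nonNegative (<⇒≤ 0<ε)}} (bernoulli N) ⟩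
        ε * 1ℚ
          ≡⟨ *-identityʳ ε ⟩
        ε ∎

    -- `σ` is the value of the full geometric series in ρ. Splitting off the first term leaves a
    -- sequence with constant A ρ, and A + A ρ σ = A σ.
    ∣partialSum∣≤ : ∀ f A → 0ℚ ≤ A → (∀ i → ∣ f i ∣ ≤ A * ρ ^ i) → ∀ n → ∣ partialSum f n ∣ ≤ A * σ
    ∣partialSum∣≤ f A 0≤A f≤ zero    = *-nonNeg 0≤A 0≤σ
    ∣partialSum∣≤ f A 0≤A f≤ (suc n) = begin
      ∣ f 0 + partialSum (f ∘ suc) n ∣
        ≤⟨ ∣+∣-mono-≤ (f 0) (partialSum (f ∘ suc) n) (f≤ 0) (∣partialSum∣≤ (f ∘ suc) (A * ρ)
             (*-nonNeg 0≤A 0≤ρ) (λ i → ≤-trans (f≤ (suc i)) (≤-reflexive (sym (*-assoc A ρ (ρ ^ i))))) n) ⟩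
      A * 1ℚ + A * ρ * σ
        ≡⟨ cong (λ s → A * s + A * ρ * σ) σ-inverse ⟨
      A * ((1ℚ - ρ) * σ) + A * ρ * σ
        ≡⟨ solve 3 (λ a r s → a :* ((con 1ℚ :- r) :* s) :+ a :* r :* s := a :* s) refl A ρ σ ⟩
      A * σ ∎

    -- Each common leading term that cancels replaces A with A ρ; m of them give the factor ρᵐ.
    ∣partialSum-tail∣≤ : ∀ f A → 0ℚ ≤ A → (∀ i → ∣ f i ∣ ≤ A * ρ ^ i) → ∀ {m n} → m ℕ.≤ n →
      ∣ partialSum f n - partialSum f m ∣ ≤ A * σ * ρ ^ m
    ∣partialSum-tail∣≤ f A 0≤A f≤ {n = n} ℕ.z≤n = begin
      ∣ partialSum f n - 0ℚ ∣  ≡⟨ cong ∣_∣ (+-identityʳ (partialSum f n)) ⟩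
      ∣ partialSum f n ∣       ≤⟨ ∣partialSum∣≤ f A 0≤A f≤ n ⟩
      A * σ                    ≡⟨ *-identityʳ (A * σ) ⟨
      A * σ * 1ℚ               ∎
    ∣partialSum-tail∣≤ f A 0≤A f≤ {suc m} {suc n} (ℕ.s≤s m≤n) = begin
      ∣ (f 0 + partialSum (f ∘ suc) n) - (f 0 + partialSum (f ∘ suc) m) ∣
        ≡⟨ cong ∣_∣ (solve 3 (λ a s t → (a :+ s) :- (a :+ t) := s :- t) refl
             (f 0) (partialSum (f ∘ suc) n) (partialSum (f ∘ suc) m)) ⟩
      ∣ partialSum (f ∘ suc) n - partialSum (f ∘ suc) m ∣
        ≤⟨ ∣partialSum-tail∣≤ (f ∘ suc) (A * ρ) (*-nonNeg 0≤A 0≤ρ)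
             (λ i → ≤-trans (f≤ (suc i)) (≤-reflexive (sym (*-assoc A ρ (ρ ^ i))))) m≤n ⟩
      A * ρ * σ * ρ ^ m
        ≡⟨ solve 4 (λ a r s p → a :* r :* s :* p := a :* s :* (r :* p)) refl A ρ σ (ρ ^ m) ⟩
      A * σ * ρ ^ suc m ∎

    1-ρ≤∣1-z∣ : ∀ z → ∣ z ∣ ≤ ρ → 1ℚ - ρ ≤ ∣ 1ℚ - z ∣
    1-ρ≤∣1-z∣ z z≤ρ = ≤-trans (+-monoʳ-≤ 1ℚ (neg-antimono-≤ z≤ρ)) (∣p∣-∣q∣≤∣p-q∣ 1ℚ z)

    -- The divisor satisfies ∣1 - z∣ ≥ 1 - ρ = 1 / σ.
    quotient-bound : ∀ u z v V → ∣ z ∣ ≤ ρ → ∣ v ∣ ≤ V → u * (1ℚ - z) ≡ v → ∣ u ∣ ≤ σ * V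
    quotient-bound u z v V z≤ρ v≤V eq = begin
      ∣ u ∣
        ≡⟨ *-identityʳ ∣ u ∣ ⟨
      ∣ u ∣ * 1ℚ
        ≡⟨ cong (∣ u ∣ *_) σ-inverse ⟨
      ∣ u ∣ * ((1ℚ - ρ) * σ)
        ≡⟨ solve 3 (λ u r s → u :* (r :* s) := s :* (u :* r)) refl ∣ u ∣ (1ℚ - ρ) σ ⟩
      σ * (∣ u ∣ * (1ℚ - ρ))
        ≤⟨ *-monoˡ-≤-nonNeg σ {{nonNegative 0≤σ}}
             (*-monoˡ-≤-nonNeg ∣ u ∣ {{∣-∣-nonNeg u}} (1-ρ≤∣1-z∣ z z≤ρ)) ⟩
      σ * (∣ u ∣ * ∣ 1ℚ - z ∣)
        ≡⟨ cong (σ *_) (trans (sym (∣p*q∣≡∣p∣*∣q∣ u (1ℚ - z))) (cong ∣_∣ eq)) ⟩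
      σ * ∣ v ∣
        ≤⟨ *-monoˡ-≤-nonNeg σ {{nonNegative 0≤σ}} v≤V ⟩
      σ * V ∎

    -- `x` and `c` are to be the values of two reals at one index of their representatives. The
    -- final bounds mention only ρ, σ and C, hence are uniform in that index.
    module Lambert (x c C : ℚ) (x≤ρ : ∣ x ∣ ≤ ρ) (c≤C : ∣ c ∣ ≤ C) (e f : ℕ → ℚ)
      (e-eq : ∀ n → e n * (1ℚ - x ^ suc (2 ℕ.* n)) ≡ c * x ^ suc (2 ℕ.* n))
      (f-eq : ∀ n → f n * (1ℚ - x ^ (2 ℕ.* suc n)) ≡ c * x ^ suc n)
      where

      ∣x^1+n∣≤ρ : ∀ n → ∣ x ^ suc n ∣ ≤ ρ
      ∣x^1+n∣≤ρ n = ≤-trans (∣x∣≤ρ⇒∣x^n∣≤ρ^n x x≤ρ (suc n)) (ρ^1+n≤ρ n)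

      ∣cx^m∣≤ : ∀ {m n} → n ℕ.≤ m → ∣ c * x ^ m ∣ ≤ C * ρ ^ n
      ∣cx^m∣≤ {m} n≤m = ∣*∣-mono-≤ c (x ^ m) c≤C
        (≤-trans (∣x∣≤ρ⇒∣x^n∣≤ρ^n x x≤ρ m) (ρ^-antimono n≤m))

      -- The exponents 2n + 1 here and n + 1 in `∣f∣≤` are both weakened to n, so that one bound
      -- serves both sequences.
      ∣e∣≤ : ∀ n → ∣ e n ∣ ≤ σ * C * ρ ^ n
      ∣e∣≤ n = ≤-trans
        (quotient-bound (e n) (x ^ suc (2 ℕ.* n)) _ (C * ρ ^ n) (∣x^1+n∣≤ρ (2 ℕ.* n))
          (∣cx^m∣≤ (ℕ.m≤n⇒m≤1+n (ℕ.m≤m+n n _))) (e-eq n))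
        (≤-reflexive (sym (*-assoc σ C (ρ ^ n))))

      ∣f∣≤ : ∀ n → ∣ f n ∣ ≤ σ * C * ρ ^ n
      ∣f∣≤ n = ≤-trans
        (quotient-bound (f n) (x ^ (2 ℕ.* suc n)) _ (C * ρ ^ n) (∣x^1+n∣≤ρ (pred (2 ℕ.* suc n)))
          (∣cx^m∣≤ (ℕ.n≤1+n n)) (f-eq n))
        (≤-reflexive (sym (*-assoc σ C (ρ ^ n))))

      0≤σC : 0ℚ ≤ σ * C
      0≤σC = *-nonNeg 0≤σ (≤-trans (0≤∣p∣ c) c≤C)

      -- Both sides are c x^((2n+1)(j+1)), reached from row n of the double sum and from its column
      -- j.
      double-sum-exponents : ∀ n j →
        c * x ^ suc (2 ℕ.* n) * (x ^ suc (2 ℕ.* n)) ^ j ≡ c * x ^ suc j * (x ^ (2 ℕ.* suc j)) ^ n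
      double-sum-exponents n j = begin-equality
        c * x ^ suc (2 ℕ.* n) * (x ^ suc (2 ℕ.* n)) ^ j
          ≡⟨ collect (suc (2 ℕ.* n)) (suc (2 ℕ.* n)) j ⟩
        c * x ^ (suc (2 ℕ.* n) ℕ.+ suc (2 ℕ.* n) ℕ.* j)
          ≡⟨ cong (λ k → c * x ^ k) (ℕ-Solver.solve 2 (λ n j →
               (one ℕ-Solver.:+ two ℕ-Solver.:* n) ℕ-Solver.:+ (one ℕ-Solver.:+ two ℕ-Solver.:* n) ℕ-Solver.:* j
               ℕ-Solver.:= (one ℕ-Solver.:+ j) ℕ-Solver.:+ (two ℕ-Solver.:* (one ℕ-Solver.:+ j)) ℕ-Solver.:* n)
               refl n j) ⟩
        c * x ^ (suc j ℕ.+ 2 ℕ.* suc j ℕ.* n)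
          ≡⟨ collect (suc j) (2 ℕ.* suc j) n ⟨
        c * x ^ suc j * (x ^ (2 ℕ.* suc j)) ^ n ∎
        where
        one two : ∀ {m} → ℕ-Solver.Polynomial m
        one = ℕ-Solver.con 1
        two = ℕ-Solver.con 2
        collect : ∀ k l i → c * x ^ k * (x ^ l) ^ i ≡ c * x ^ (k ℕ.+ l ℕ.* i)
        collect k l i = begin-equality
          c * x ^ k * (x ^ l) ^ i       ≡⟨ cong (c * x ^ k *_) (^-assocʳ x l i) ⟩
          c * x ^ k * x ^ (l ℕ.* i)     ≡⟨ *-assoc c (x ^ k) _ ⟩
          c * (x ^ k * x ^ (l ℕ.* i))   ≡⟨ cong (c *_) (^-homo-* x k (l ℕ.* i)) ⟨
          c * x ^ (k ℕ.+ l ℕ.* i)       ∎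

      -- Expanding both quotients to N terms of their geometric series gives the same N × N double sum.
      partialSum-difference : ∀ N → ∣ partialSum e N - partialSum f N ∣ ≤ (σ * C + σ * C) * σ * ρ ^ N
      partialSum-difference N = begin
        ∣ partialSum e N - partialSum f N ∣
          ≡⟨ cong ∣_∣ (cong₂ _-_
               (expansion e (λ n → x ^ suc (2 ℕ.* n)) (λ n → c * x ^ suc (2 ℕ.* n)) e-eq)
               (expansion f (λ j → x ^ (2 ℕ.* suc j)) (λ j → c * x ^ suc j) f-eq)) ⟩
        ∣ (partialSum (λ n → partialSum (double n) N) N + partialSum e-rest N)
          - (partialSum (λ j → partialSum (double′ j) N) N + partialSum f-rest N) ∣
          ≡⟨ cong (λ s → ∣ (s + partialSum e-rest N)
               - (partialSum (λ j → partialSum (double′ j) N) N + partialSum f-rest N) ∣) swap ⟩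
        ∣ (partialSum (λ j → partialSum (double′ j) N) N + partialSum e-rest N)
          - (partialSum (λ j → partialSum (double′ j) N) N + partialSum f-rest N) ∣
          ≡⟨ cong ∣_∣ (solve 3 (λ d a b → (d :+ a) :- (d :+ b) := a :- b) refl
               (partialSum (λ j → partialSum (double′ j) N) N) (partialSum e-rest N) (partialSum f-rest N)) ⟩
        ∣ partialSum e-rest N - partialSum f-rest N ∣
          ≤⟨ ∣-∣-mono-≤ (partialSum e-rest N) (partialSum f-rest N)
               (rest-bound e (λ n → 2 ℕ.* n) ∣e∣≤) (rest-bound f (λ j → pred (2 ℕ.* suc j)) ∣f∣≤) ⟩
        ρ ^ N * (σ * C) * σ + ρ ^ N * (σ * C) * σ
          ≡⟨ solve 3 (λ p k s → p :* k :* s :+ p :* k :* s := (k :+ k) :* s :* p) refl (ρ ^ N) (σ * C) σ ⟩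
        (σ * C + σ * C) * σ * ρ ^ N ∎
        where
        double double′ : ℕ → ℕ → ℚ
        double  n j = c * x ^ suc (2 ℕ.* n) * (x ^ suc (2 ℕ.* n)) ^ j
        double′ j n = c * x ^ suc j * (x ^ (2 ℕ.* suc j)) ^ n
        e-rest f-rest : ℕ → ℚ
        e-rest n = (x ^ suc (2 ℕ.* n)) ^ N * e n
        f-rest j = (x ^ (2 ℕ.* suc j)) ^ N * f j
        expansion : ∀ (u z v : ℕ → ℚ) → (∀ n → u n * (1ℚ - z n) ≡ v n) →
          partialSum u N ≡ partialSum (λ n → partialSum (λ j → v n * z n ^ j) N) N
                         + partialSum (λ n → z n ^ N * u n) N
        expansion u z v eq = trans
          (sum-cong-≗ {N} (λ i → geometric-expansion (eq (toℕ i)) N))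
          (∑-distrib-+ {N} (λ i → partialSum (λ j → v (toℕ i) * z (toℕ i) ^ j) N)
                           (λ i → z (toℕ i) ^ N * u (toℕ i)))
        swap : partialSum (λ n → partialSum (double n) N) N ≡ partialSum (λ j → partialSum (double′ j) N) N
        swap = trans (∑-comm {N} {N} (λ i j → double (toℕ i) (toℕ j)))
          (sum-cong-≗ {N} (λ j → sum-cong-≗ {N} (λ i → double-sum-exponents (toℕ i) (toℕ j))))
        -- A positive exponent `suc (k n)` makes the base at most ρ in absolute value, so its N-th
        -- power supplies the factor ρ^N of the remainder.
        rest-bound : ∀ (u : ℕ → ℚ) (k : ℕ → ℕ) → (∀ n → ∣ u n ∣ ≤ σ * C * ρ ^ n) →
          ∣ partialSum (λ n → (x ^ suc (k n)) ^ N * u n) N ∣ ≤ ρ ^ N * (σ * C) * σ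
        rest-bound u k u≤ = ∣partialSum∣≤ _ (ρ ^ N * (σ * C)) (*-nonNeg (0≤ρ^ N) 0≤σC)
          (λ n → ≤-trans
            (∣*∣-mono-≤ ((x ^ suc (k n)) ^ N) (u n) (∣x∣≤ρ⇒∣x^n∣≤ρ^n _ (∣x^1+n∣≤ρ (k n)) N) (u≤ n))
            (≤-reflexive (sym (*-assoc (ρ ^ N) (σ * C) (ρ ^ n))))) N

open import Defs
open RationalEstimates
open RationalLemmas

-- The ring of real numbers

half : ∀ ε → 0ℚ ℚ.< ε → ∃[ δ ] 0ℚ ℚ.< δ × δ ℚ.+ δ ≡ ε
half ε 0<ε = ½ ℚ.* ε , *-pos (ℚ.positive⁻¹ ½) 0<ε ,
  solve 1 (λ e → con ½ :* e :+ con ½ :* e := e) refl ε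

infix 4 _≃_

-- The type x ≈ y unfolds to a statement about seq x and seq y, from which Agda
-- cannot recover x and y; a record keeps them inferable.
record _≃_ (x y : ℝ) : Set where
  constructor wrap
  field unwrap : x ≈ y

open _≃_

-- Operations act termwise on representatives, so this transfers the ring laws and all polynomial
-- identities from the rationals.
pointwise : ∀ {x y} → (∀ n → seq x n ≡ seq y n) → x ≃ y
pointwise {x} {y} x≡y = wrap λ ε 0<ε → 0 , λ n _ → ℚ.≤-<-trans
  (ℚ.≤-reflexive (cong ℚ.∣_∣ (trans (cong (ℚ._- seq y n) (x≡y n)) (ℚ.+-inverseʳ (seq y n))))) 0<ε

≃-refl : ∀ {x} → x ≃ x
≃-refl = pointwise λ _ → refl

≃-sym : ∀ {x y} → x ≃ y → y ≃ x
≃-sym {x} {y} x≃y = wrap λ ε 0<ε → let N , near = unwrap x≃y ε 0<ε in N , λ n N≤n →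
  ℚ.≤-<-trans (ℚ.≤-reflexive (∣p-q∣≡∣q-p∣ (seq y n) (seq x n))) (near n N≤n)

-- The common core of transitivity and of congruence for sums and products: it suffices to bring
-- each of the two given differences below ε / (2K).
≃-lipschitz : ∀ {x x′ y y′ z z′} → x ≃ x′ → y ≃ y′ → ∀ K N₀ → 0ℚ ℚ.< K →
  (∀ n → N₀ ℕ.≤ n →
    ℚ.∣ seq z n ℚ.- seq z′ n ∣ ℚ.≤ K ℚ.* (ℚ.∣ seq x n ℚ.- seq x′ n ∣ ℚ.+ ℚ.∣ seq y n ℚ.- seq y′ n ∣)) →
  z ≃ z′
≃-lipschitz {x} {x′} {y} {y′} {z} {z′} x≃x′ y≃y′ K N₀ 0<K bound = wrap λ ε 0<ε →
  let L , 0<L , KL≡1 = 1/₊ K 0<K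
      δ , 0<δ , δ+δ≡Lε = half (L ℚ.* ε) (*-pos 0<L 0<ε)
      N₁ , near₁ = unwrap x≃x′ δ 0<δ
      N₂ , near₂ = unwrap y≃y′ δ 0<δ
  in N₀ ℕ.⊔ (N₁ ℕ.⊔ N₂) , λ n N≤n →
    let N₁₂≤n = ℕ.m⊔n≤o⇒n≤o N₀ _ N≤n in begin-strict
    ℚ.∣ seq z n ℚ.- seq z′ n ∣
      ≤⟨ bound n (ℕ.m⊔n≤o⇒m≤o N₀ _ N≤n) ⟩
    K ℚ.* (ℚ.∣ seq x n ℚ.- seq x′ n ∣ ℚ.+ ℚ.∣ seq y n ℚ.- seq y′ n ∣)
      <⟨ ℚ.*-monoʳ-<-pos K {{ℚ.positive 0<K}}
           (ℚ.+-mono-< (near₁ n (ℕ.m⊔n≤o⇒m≤o N₁ N₂ N₁₂≤n)) (near₂ n (ℕ.m⊔n≤o⇒n≤o N₁ N₂ N₁₂≤n))) ⟩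
    K ℚ.* (δ ℚ.+ δ)     ≡⟨ cong (K ℚ.*_) δ+δ≡Lε ⟩
    K ℚ.* (L ℚ.* ε)     ≡⟨ ℚ.*-assoc K L ε ⟨
    K ℚ.* L ℚ.* ε       ≡⟨ cong (ℚ._* ε) KL≡1 ⟩
    1ℚ ℚ.* ε            ≡⟨ ℚ.*-identityˡ ε ⟩
    ε                   ∎
  where open ℚ.≤-Reasoning

≃-trans : ∀ {x y z} → x ≃ y → y ≃ z → x ≃ z
≃-trans {x} {y} {z} x≃y y≃z = ≃-lipschitz x≃y y≃z 1ℚ 0 (ℚ.positive⁻¹ 1ℚ) λ n _ → begin
  ℚ.∣ seq x n ℚ.- seq z n ∣
    ≡⟨ cong ℚ.∣_∣ (solve 3 (λ x y z → x :- z := (x :+ y) :- (y :+ z)) refl (seq x n) (seq y n) (seq z n)) ⟩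
  ℚ.∣ (seq x n ℚ.+ seq y n) ℚ.- (seq y n ℚ.+ seq z n) ∣
    ≤⟨ +-diff (seq x n) (seq y n) (seq y n) (seq z n) ⟩
  1ℚ ℚ.* (ℚ.∣ seq x n ℚ.- seq y n ∣ ℚ.+ ℚ.∣ seq y n ℚ.- seq z n ∣) ∎
  where open ℚ.≤-Reasoning

+-cong : ∀ {x x′ y y′} → x ≃ x′ → y ≃ y′ → x + y ≃ x′ + y′
+-cong {x} {x′} {y} {y′} x≃x′ y≃y′ =
  ≃-lipschitz x≃x′ y≃y′ 1ℚ 0 (ℚ.positive⁻¹ 1ℚ) λ n _ →
    +-diff (seq x n) (seq y n) (seq x′ n) (seq y′ n)

*-cong : ∀ {x x′ y y′} → x ≃ x′ → y ≃ y′ → x * y ≃ x′ * y′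
*-cong {x} {x′} {y} {y′} x≃x′ y≃y′ =
  let A , A>0 , N₁ , x≤A = bounded (seq x) (cauchy x)
      B , B>0 , N₂ , y′≤B = bounded (seq y′) (cauchy y′)
  in ≃-lipschitz x≃x′ y≃y′ (A ℚ.+ B) (N₁ ℕ.⊔ N₂) (+-pos A>0 B>0) λ n N≤n →
    *-diff (seq x n) (seq y n) (seq x′ n) (seq y′ n) (A ℚ.+ B)
      (ℚ.≤-trans (x≤A n (ℕ.m⊔n≤o⇒m≤o N₁ N₂ N≤n)) (p≤p+q A (ℚ.<⇒≤ B>0)))
      (ℚ.≤-trans (y′≤B n (ℕ.m⊔n≤o⇒n≤o N₁ N₂ N≤n)) (p≤q+p B (ℚ.<⇒≤ A>0)))

-‿cong : ∀ {x y} → x ≃ y → - x ≃ - y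
-‿cong {x} {y} x≃y = wrap λ ε 0<ε → let N , near = unwrap x≃y ε 0<ε in N , λ n N≤n → ℚ.≤-<-trans
  (ℚ.≤-reflexive (trans
    (cong ℚ.∣_∣ (solve 2 (λ a b → :- a :- :- b := :- (a :- b)) refl (seq x n) (seq y n)))
    (ℚ.∣-p∣≡∣p∣ (seq x n ℚ.- seq y n))))
  (near n N≤n)

∣-∣-cong : ∀ {x y} → x ≃ y → ∣ x ∣ ≃ ∣ y ∣
∣-∣-cong {x} {y} x≃y = wrap λ ε 0<ε → let N , near = unwrap x≃y ε 0<ε in N , λ n N≤n →
  ℚ.≤-<-trans (∣∣p∣-∣q∣∣≤∣p-q∣ (seq x n) (seq y n)) (near n N≤n)

ℝ-commutativeRing : CommutativeRing 0ℓ 0ℓ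
ℝ-commutativeRing = record
  { Carrier = ℝ ; _≈_ = _≃_ ; _+_ = _+_ ; _*_ = _*_ ; -_ = -_ ; 0# = 0ℝ ; 1# = 1ℝ
  ; isCommutativeRing = record
    { isRing = record
      { +-isAbelianGroup = record
        { isGroup = record
          { isMonoid = record
            { isSemigroup = record
              { isMagma = record
                { isEquivalence = record
                  { refl  = ≃-refl
                  ; sym   = ≃-sym
                  ; trans = ≃-trans }
                ; ∙-cong = +-cong }
              ; assoc = λ x y z → pointwise λ n → ℚ.+-assoc (seq x n) (seq y n) (seq z n) }
            ; identity = (λ x → pointwise λ n → ℚ.+-identityˡ (seq x n))
                       , (λ x → pointwise λ n → ℚ.+-identityʳ (seq x n)) }
          ; inverse = (λ x → pointwise λ n → ℚ.+-inverseˡ (seq x n))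
                    , (λ x → pointwise λ n → ℚ.+-inverseʳ (seq x n))
          ; ⁻¹-cong = -‿cong }
        ; comm = λ x y → pointwise λ n → ℚ.+-comm (seq x n) (seq y n) }
      ; *-cong = *-cong
      ; *-assoc = λ x y z → pointwise λ n → ℚ.*-assoc (seq x n) (seq y n) (seq z n)
      ; *-identity = (λ x → pointwise λ n → ℚ.*-identityˡ (seq x n))
                   , (λ x → pointwise λ n → ℚ.*-identityʳ (seq x n))
      ; distrib = (λ x y z → pointwise λ n → ℚ.*-distribˡ-+ (seq x n) (seq y n) (seq z n))
                , (λ x y z → pointwise λ n → ℚ.*-distribʳ-+ (seq x n) (seq y n) (seq z n)) }
    ; *-comm = λ x y → pointwise λ n → ℚ.*-comm (seq x n) (seq y n) } }

module ℝR = CommutativeRing ℝ-commutativeRing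
module ≃-Reasoning = SetoidReasoning ℝR.setoid

open import Algebra.Properties.Semiring.Sum ℝR.semiring using (sum-cong-≋)

-- `seq-^` and `seq-sum` read powers and finite sums at a single index, where the rational laws and
-- estimates apply.
seq-^ : ∀ x n m → seq (x ^ n) m ≡ seq x m ℚ^.^ n
seq-^ x zero    m = refl
seq-^ x (suc n) m = cong (seq x m ℚ.*_) (seq-^ x n m)

seq-sum : ∀ (t : ℕ → ℝ) n m → seq (sum {n} (t ∘ toℕ)) m ≡ partialSum (λ i → seq (t i) m) n
seq-sum t zero    m = refl
seq-sum t (suc n) m = cong (seq (t 0) m ℚ.+_) (seq-sum (t ∘ suc) n m)

-- The library's laws of _^_ for ℝ-commutativeRing concern powers over a raw ring with
-- _≃_ in place of _≈_, which Agda does not identify with those of Defs.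
^-congˡ : ∀ n {x y} → x ≃ y → x ^ n ≃ y ^ n
^-congˡ zero    x≃y = ≃-refl
^-congˡ (suc n) x≃y = *-cong x≃y (^-congˡ n x≃y)

^-homo-* : ∀ x m n → x ^ (m ℕ.+ n) ≃ x ^ m * x ^ n
^-homo-* x m n = pointwise λ k → trans (seq-^ x (m ℕ.+ n) k) (trans
  (ℚ^.^-homo-* (seq x k) m n)
  (sym (cong₂ ℚ._*_ (seq-^ x m k) (seq-^ x n k))))

^-assocʳ : ∀ x m n → (x ^ m) ^ n ≃ x ^ (m ℕ.* n)
^-assocʳ x m n = pointwise λ k → trans (seq-^ (x ^ m) n k) (trans
  (cong (ℚ^._^ n) (seq-^ x m k)) (trans
  (ℚ^.^-assocʳ (seq x k) m n)
  (sym (seq-^ x (m ℕ.* n) k))))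

^-distrib-* : ∀ x y n → (x * y) ^ n ≃ x ^ n * y ^ n
^-distrib-* x y n = pointwise λ k → trans (seq-^ (x * y) n k) (trans
  (ℚ^.^-distrib-* (seq x k) (seq y k) n)
  (sym (cong₂ ℚ._*_ (seq-^ x n k) (seq-^ y n k))))

-- Reals bounded away from 0

-- Apartness from 0 without a choice of sign, so that products and powers need no case distinction;
-- `#⇒Away` and `Away⇒#` convert between the two forms.
record Away (x : ℝ) : Set where
  constructor away
  field
    distance   : ℚ
    distance>0 : 0ℚ ℚ.< distance
    index      : ℕ
    far        : ∀ n → index ℕ.≤ n → distance ℚ.≤ ℚ.∣ seq x n ∣

#⇒Away : ∀ {x} → x # 0ℝ → Away x
#⇒Away {x} x#0 = let ε , 0<ε , N , ε≤ = awayFrom0 x 0ℝ (λ _ → refl) x#0 in away ε 0<ε N ε≤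

far-near : ∀ {δ} a b → δ ℚ.+ δ ℚ.≤ a → ℚ.∣ a ℚ.- b ∣ ℚ.≤ δ → δ ℚ.≤ b
far-near {δ} a b 2δ≤a ∣a-b∣≤δ = begin
  δ                          ≡⟨ solve 1 (λ d → d := d :+ d :- d) refl δ ⟩
  δ ℚ.+ δ ℚ.- δ              ≤⟨ ℚ.+-mono-≤ 2δ≤a (ℚ.neg-antimono-≤ (ℚ.≤-trans (p≤∣p∣ (a ℚ.- b)) ∣a-b∣≤δ)) ⟩
  a ℚ.- (a ℚ.- b)            ≡⟨ solve 2 (λ a b → a :- (a :- b) := b) refl a b ⟩
  b                          ∎
  where open ℚ.≤-Reasoning

far-near-neg : ∀ {δ} a b → δ ℚ.+ δ ℚ.≤ ℚ.- a → ℚ.∣ a ℚ.- b ∣ ℚ.≤ δ → b ℚ.+ δ ℚ.≤ 0ℚ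
far-near-neg {δ} a b 2δ≤-a ∣a-b∣≤δ = begin
  b ℚ.+ δ            ≤⟨ ℚ.+-monoʳ-≤ b (far-near (ℚ.- a) (ℚ.- b) 2δ≤-a ∣-a+b∣≤δ) ⟩
  b ℚ.+ (ℚ.- b)      ≡⟨ ℚ.+-inverseʳ b ⟩
  0ℚ                 ∎
  where
  open ℚ.≤-Reasoning
  ∣-a+b∣≤δ : ℚ.∣ ℚ.- a ℚ.- (ℚ.- b) ∣ ℚ.≤ δ
  ∣-a+b∣≤δ = begin
    ℚ.∣ ℚ.- a ℚ.- (ℚ.- b) ∣  ≡⟨ cong ℚ.∣_∣ (solve 2 (λ a b → :- a :- :- b := :- (a :- b)) refl a b) ⟩
    ℚ.∣ ℚ.- (a ℚ.- b) ∣      ≡⟨ ℚ.∣-p∣≡∣p∣ (a ℚ.- b) ⟩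
    ℚ.∣ a ℚ.- b ∣            ≤⟨ ∣a-b∣≤δ ⟩
    δ                        ∎

p≤0⇒∣p∣≡-p : ∀ {p} → p ℚ.≤ 0ℚ → ℚ.∣ p ∣ ≡ ℚ.- p
p≤0⇒∣p∣≡-p {p} p≤0 = trans (sym (ℚ.∣-p∣≡∣p∣ p)) (ℚ.0≤p⇒∣p∣≡p (ℚ.neg-antimono-≤ {p} {0ℚ} p≤0))

-- The sign of x is read off at an index beyond which x varies by less than half its distance from 0.
Away⇒# : ∀ {x} → Away x → x # 0ℝ
Away⇒# {x} (away ε 0<ε N₁ ε≤) =
  let δ , 0<δ , δ+δ≡ε = half ε 0<ε
      N₂ , near = cauchy x δ 0<δ
      M = N₁ ℕ.⊔ N₂
      2δ≤∣x∣ = ℚ.≤-trans (ℚ.≤-reflexive δ+δ≡ε) (ε≤ M (ℕ.m≤m⊔n N₁ N₂))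
      near-M = λ n (M≤n : M ℕ.≤ n) → ℚ.<⇒≤ (near M n (ℕ.m≤n⊔m N₁ N₂) (ℕ.m⊔n≤o⇒n≤o N₁ N₂ M≤n))
      positive : 0ℚ ℚ.≤ seq x M → 0ℝ < x
      positive 0≤x = δ , 0<δ , M , λ n M≤n →
        ℚ.≤-trans (ℚ.≤-reflexive (ℚ.+-identityˡ δ)) (far-near {δ} (seq x M) (seq x n)
          (ℚ.≤-trans 2δ≤∣x∣ (ℚ.≤-reflexive (ℚ.0≤p⇒∣p∣≡p 0≤x))) (near-M n M≤n))
      negative : seq x M ℚ.≤ 0ℚ → x < 0ℝ
      negative x≤0 = δ , 0<δ , M , λ n M≤n →
        far-near-neg {δ} (seq x M) (seq x n)
          (ℚ.≤-trans 2δ≤∣x∣ (ℚ.≤-reflexive (p≤0⇒∣p∣≡-p x≤0))) (near-M n M≤n)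
  in [ (λ 0≤x → inj₂ (positive 0≤x)) , (λ x≤0 → inj₁ (negative x≤0)) ]′ (ℚ.≤-total 0ℚ (seq x M))

Away-resp-≃ : ∀ {x y} → x ≃ y → Away x → Away y
Away-resp-≃ {x} {y} x≃y (away ε 0<ε N₁ ε≤) =
  let δ , 0<δ , δ+δ≡ε = half ε 0<ε
      N₂ , near = unwrap x≃y δ 0<δ
  in away δ 0<δ (N₁ ℕ.⊔ N₂) λ n N≤n → far-near {δ} ℚ.∣ seq x n ∣ ℚ.∣ seq y n ∣
    (ℚ.≤-trans (ℚ.≤-reflexive δ+δ≡ε) (ε≤ n (ℕ.m⊔n≤o⇒m≤o N₁ N₂ N≤n)))
    (ℚ.≤-trans (∣∣p∣-∣q∣∣≤∣p-q∣ (seq x n) (seq y n)) (ℚ.<⇒≤ (near n (ℕ.m⊔n≤o⇒n≤o N₁ N₂ N≤n))))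

Away-* : ∀ {x y} → Away x → Away y → Away (x * y)
Away-* {x} {y} (away ε 0<ε N₁ ε≤) (away δ 0<δ N₂ δ≤) = away (ε ℚ.* δ) (*-pos 0<ε 0<δ) (N₁ ℕ.⊔ N₂) λ n N≤n →
  ℚ.≤-trans
    (*-mono-≤ (ℚ.<⇒≤ 0<δ) (ℚ.0≤∣p∣ (seq x n)) (ε≤ n (ℕ.m⊔n≤o⇒m≤o N₁ N₂ N≤n)) (δ≤ n (ℕ.m⊔n≤o⇒n≤o N₁ N₂ N≤n)))
    (ℚ.≤-reflexive (sym (ℚ.∣p*q∣≡∣p∣*∣q∣ (seq x n) (seq y n))))

Away-^ : ∀ {x} → Away x → ∀ n → Away (x ^ n)
Away-^ x#0 zero    = away 1ℚ (ℚ.positive⁻¹ 1ℚ) 0 λ _ _ → ℚ.≤-refl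
Away-^ x#0 (suc n) = Away-* x#0 (Away-^ x#0 n)

≤B*q⇒L*≤q : ∀ {B L ε q} → 0ℚ ℚ.< L → B ℚ.* L ≡ 1ℚ → ε ℚ.≤ B ℚ.* q → L ℚ.* ε ℚ.≤ q
≤B*q⇒L*≤q {B} {L} {ε} {q} 0<L BL≡1 ε≤Bq = begin
  L ℚ.* ε          ≤⟨ ℚ.*-monoˡ-≤-nonNeg L {{ℚ.nonNegative (ℚ.<⇒≤ 0<L)}} ε≤Bq ⟩
  L ℚ.* (B ℚ.* q)  ≡⟨ solve 3 (λ l b q → l :* (b :* q) := b :* l :* q) refl L B q ⟩
  B ℚ.* L ℚ.* q    ≡⟨ cong (ℚ._* q) BL≡1 ⟩
  1ℚ ℚ.* q         ≡⟨ ℚ.*-identityˡ q ⟩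
  q                ∎
  where open ℚ.≤-Reasoning

-- If ∣x∣ ≤ B eventually, then ∣y∣ ≥ ∣x y∣ / B there. This extracts the apartness of Uₙ from that of
-- (α - β) Uₙ.
Away-*⁻ʳ : ∀ {x y} → Away (x * y) → Away y
Away-*⁻ʳ {x} {y} (away ε 0<ε N₁ ε≤) =
  let B , 0<B , N₂ , x≤B = bounded (seq x) (cauchy x)
      L , 0<L , BL≡1 = 1/₊ B 0<B
  in away (L ℚ.* ε) (*-pos 0<L 0<ε) (N₁ ℕ.⊔ N₂) λ n N≤n →
    ≤B*q⇒L*≤q {B} {L} {ε} {ℚ.∣ seq y n ∣} 0<L BL≡1 (ℚ.≤-trans (ε≤ n (ℕ.m⊔n≤o⇒m≤o N₁ N₂ N≤n))
      (∣*∣-mono-≤ (seq x n) (seq y n) (x≤B n (ℕ.m⊔n≤o⇒n≤o N₁ N₂ N≤n)) ℚ.≤-refl))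

*-recip : ∀ p → p ≢ 0ℚ → p ℚ.* recip p ≡ 1ℚ
*-recip p p≢0 with p ℚ.≟ 0ℚ
... | yes p≡0 = contradiction p≡0 p≢0
... | no  p≢0 = ℚ.*-inverseʳ p {{ℚ.≢-nonZero p≢0}}

≤∣p∣⇒≢0 : ∀ {ε p} → 0ℚ ℚ.< ε → ε ℚ.≤ ℚ.∣ p ∣ → p ≢ 0ℚ
≤∣p∣⇒≢0 0<ε ε≤0 refl = ℚ.<-irrefl refl (ℚ.<-≤-trans 0<ε ε≤0)

-- The terms may disagree at early indices where y vanishes and `recip` takes its default value;
-- past the index N of `Away` they agree exactly.
/-* : ∀ x y (y#0 : y # 0ℝ) → x / y [ y#0 ] * y ≃ x
/-* x y y#0 = wrap λ ε 0<ε → let away δ 0<δ N δ≤ = #⇒Away {y} y#0 in N , λ n N≤n →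
  ℚ.≤-<-trans (ℚ.≤-reflexive (cong ℚ.∣_∣ (cancel (seq x n) (seq y n) (≤∣p∣⇒≢0 0<δ (δ≤ n N≤n))))) 0<ε
  where
  open ℚ.≤-Reasoning
  cancel : ∀ p q → q ≢ 0ℚ → p ℚ.* recip q ℚ.* q ℚ.- p ≡ 0ℚ
  cancel p q q≢0 = begin-equality
    p ℚ.* recip q ℚ.* q ℚ.- p    ≡⟨ solve 3 (λ p q r → p :* r :* q :- p := p :* (q :* r) :- p) refl p q (recip q) ⟩
    p ℚ.* (q ℚ.* recip q) ℚ.- p  ≡⟨ cong (λ r → p ℚ.* r ℚ.- p) (*-recip q q≢0) ⟩
    p ℚ.* 1ℚ ℚ.- p               ≡⟨ solve 1 (λ p → p :* con 1ℚ :- p := con 0ℚ) refl p ⟩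
    0ℚ                           ∎

*-cancelˡ : ∀ {x y z} → Away z → z * x ≃ z * y → x ≃ y
*-cancelˡ {x} {y} {z} z#0 zx≃zy = begin
  x              ≈⟨ expand x ⟩
  w * (z * x)    ≈⟨ ℝR.*-congˡ zx≃zy ⟩
  w * (z * y)    ≈⟨ expand y ⟨
  y              ∎
  where
  open ≃-Reasoning
  w = 1ℝ / z [ Away⇒# z#0 ]
  expand : ∀ u → u ≃ w * (z * u)
  expand u = begin
    u            ≈⟨ ℝR.*-identityˡ u ⟨
    1ℝ * u       ≈⟨ ℝR.*-congʳ (/-* 1ℝ z (Away⇒# z#0)) ⟨
    w * z * u    ≈⟨ ℝR.*-assoc w z u ⟩
    w * (z * u)  ∎

-- Limits and series

<-respˡ-≃ : ∀ {x x′ y} → x ≃ x′ → x < y → x′ < y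
<-respˡ-≃ {x} {x′} {y} x≃x′ (ε , 0<ε , N₁ , x+ε≤y) =
  let δ , 0<δ , δ+δ≡ε = half ε 0<ε
      N₂ , near = unwrap x≃x′ δ 0<δ
  in δ , 0<δ , N₁ ℕ.⊔ N₂ , λ n N≤n → begin
  seq x′ n ℚ.+ δ
    ≡⟨ solve 3 (λ a b d → b :+ d := a :+ (b :- a) :+ d) refl (seq x n) (seq x′ n) δ ⟩
  seq x n ℚ.+ (seq x′ n ℚ.- seq x n) ℚ.+ δ
    ≤⟨ ℚ.+-monoˡ-≤ δ (ℚ.+-monoʳ-≤ (seq x n) (ℚ.≤-trans (p≤∣p∣ _)
         (ℚ.≤-trans (ℚ.≤-reflexive (∣p-q∣≡∣q-p∣ (seq x′ n) (seq x n)))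
           (ℚ.<⇒≤ (near n (ℕ.m⊔n≤o⇒n≤o N₁ N₂ N≤n)))))) ⟩
  seq x n ℚ.+ δ ℚ.+ δ
    ≡⟨ ℚ.+-assoc (seq x n) δ δ ⟩
  seq x n ℚ.+ (δ ℚ.+ δ)
    ≡⟨ cong (seq x n ℚ.+_) δ+δ≡ε ⟩
  seq x n ℚ.+ ε
    ≤⟨ x+ε≤y n (ℕ.m⊔n≤o⇒m≤o N₁ N₂ N≤n) ⟩
  seq y n ∎
  where open ℚ.≤-Reasoning

ConvergesTo-resp-≃ : ∀ {s s′ L} → (∀ n → s n ≃ s′ n) → ConvergesTo s L → ConvergesTo s′ L
ConvergesTo-resp-≃ {s} {s′} {L} s≃s′ s→L ε 0<ε = let N , close = s→L ε 0<ε in N , λ n N≤n →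
  <-respˡ-≃ {∣ s n - L ∣} {∣ s′ n - L ∣} {ε} (∣-∣-cong (+-cong (s≃s′ n) ≃-refl)) (close n N≤n)

HasSum-resp-≃ : ∀ {t t′ S} → (∀ n → t n ≃ t′ n) → HasSum t S → HasSum t′ S
HasSum-resp-≃ {t} {t′} {S} t≃t′ =
  ConvergesTo-resp-≃ {λ N → sum {N} (λ i → t (toℕ i))} {λ N → sum {N} (λ i → t′ (toℕ i))} {S}
    (λ N → sum-cong-≋ {N} (λ i → t≃t′ (toℕ i)))

-- The threshold M may depend on n, since the order on reals disregards initial segments of
-- representatives.
termwise-convergence : ∀ s L →
  (∀ ε → 0ℚ ℚ.< ε → ∃[ N ] ∀ n → N ℕ.≤ n → ∃[ M ] ∀ m → M ℕ.≤ m → ℚ.∣ seq (s n) m ℚ.- seq L m ∣ ℚ.≤ ε) →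
  ConvergesTo s L
termwise-convergence s L close ε (e , 0<e , M₁ , e≤ε) =
  -- One half of e bounds the distance; the other is the gap that the strict inequality demands.
  let δ , 0<δ , δ+δ≡e = half e 0<e
      N , close-N = close δ 0<δ
  in N , λ n N≤n →
  let M₂ , close-n = close-N n N≤n in δ , 0<δ , M₁ ℕ.⊔ M₂ , λ m M≤m → begin
  ℚ.∣ seq (s n) m ℚ.- seq L m ∣ ℚ.+ δ  ≤⟨ ℚ.+-monoˡ-≤ δ (close-n m (ℕ.m⊔n≤o⇒n≤o M₁ M₂ M≤m)) ⟩
  δ ℚ.+ δ                              ≡⟨ ℚ.+-identityˡ (δ ℚ.+ δ) ⟨
  0ℚ ℚ.+ (δ ℚ.+ δ)                     ≡⟨ cong (0ℚ ℚ.+_) δ+δ≡e ⟩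
  0ℚ ℚ.+ e                             ≤⟨ e≤ε m (ℕ.m⊔n≤o⇒m≤o M₁ M₂ M≤m) ⟩
  seq ε m                              ∎
  where open ℚ.≤-Reasoning

∣p-r∣≤ : ∀ p q r {δ ε} → ℚ.∣ p ℚ.- q ∣ ℚ.≤ δ → ℚ.∣ q ℚ.- r ∣ ℚ.≤ ε → ℚ.∣ p ℚ.- r ∣ ℚ.≤ δ ℚ.+ ε
∣p-r∣≤ p q r pq≤δ qr≤ε = ℚ.≤-trans
  (ℚ.≤-reflexive (cong ℚ.∣_∣ (solve 3 (λ p q r → p :- r := (p :- q) :+ (q :- r)) refl p q r)))
  (∣+∣-mono-≤ (p ℚ.- q) (q ℚ.- r) pq≤δ qr≤ε)

-- A single N bounds the positions n, n′ and the index m of the representatives; this uniformity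
-- permits taking the diagonal.
UniformlyClose : (s t : ℕ → ℝ) → Set
UniformlyClose s t = ∀ ε → 0ℚ ℚ.< ε → ∃[ N ] ∀ n n′ m → N ℕ.≤ n → N ℕ.≤ n′ → N ℕ.≤ m →
  ℚ.∣ seq (s n) m ℚ.- seq (t n′) m ∣ ℚ.≤ ε

-- The limit of s is represented by its diagonal.
diagonal-cauchy : ∀ s → UniformlyClose s s → Cauchy (λ m → seq (s m) m)
diagonal-cauchy s close ε 0<ε =
  -- Two quarters of ε pay for replacing `s m` and `s n` by the one real `s N₁`, the remaining half
  -- for moving along its representative.
  let δ , 0<δ , δ+δ≡ε = half ε 0<ε
      η , 0<η , η+η≡δ = half δ 0<δ
      N₁ , close-N = close η 0<η
      N₂ , near = cauchy (s N₁) δ 0<δ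
  in N₁ ℕ.⊔ N₂ , λ m n N≤m N≤n →
    let N₁≤m = ℕ.m⊔n≤o⇒m≤o N₁ N₂ N≤m ; N₁≤n = ℕ.m⊔n≤o⇒m≤o N₁ N₂ N≤n in begin-strict
    ℚ.∣ seq (s m) m ℚ.- seq (s n) n ∣
      ≡⟨ cong ℚ.∣_∣ (solve 4 (λ a b c d → a :- d := ((a :- b) :+ (c :- d)) :+ (b :- c)) refl
           (seq (s m) m) (seq (s N₁) m) (seq (s N₁) n) (seq (s n) n)) ⟩
    ℚ.∣ ((seq (s m) m ℚ.- seq (s N₁) m) ℚ.+ (seq (s N₁) n ℚ.- seq (s n) n)) ℚ.+ (seq (s N₁) m ℚ.- seq (s N₁) n) ∣
      ≤⟨ ∣+∣-mono-≤ _ _ (∣+∣-mono-≤ (seq (s m) m ℚ.- seq (s N₁) m) (seq (s N₁) n ℚ.- seq (s n) n)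
           (close-N m N₁ m N₁≤m ℕ.≤-refl N₁≤m) (close-N N₁ n n ℕ.≤-refl N₁≤n N₁≤n)) ℚ.≤-refl ⟩
    (η ℚ.+ η) ℚ.+ ℚ.∣ seq (s N₁) m ℚ.- seq (s N₁) n ∣
      <⟨ ℚ.+-monoʳ-< (η ℚ.+ η) (near m n (ℕ.m⊔n≤o⇒n≤o N₁ N₂ N≤m) (ℕ.m⊔n≤o⇒n≤o N₁ N₂ N≤n)) ⟩
    (η ℚ.+ η) ℚ.+ δ  ≡⟨ cong (ℚ._+ δ) η+η≡δ ⟩
    δ ℚ.+ δ          ≡⟨ δ+δ≡ε ⟩
    ε                ∎
  where open ℚ.≤-Reasoning

-- Allowing t to differ from s is what gives both series the same sum. The diagonal is reached by
-- taking n′ = m.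
diagonal-limit : ∀ s t L → (∀ m → seq L m ≡ seq (s m) m) → UniformlyClose t s → ConvergesTo t L
diagonal-limit s t L L≡ close = termwise-convergence t L λ ε 0<ε →
  let N , close-N = close ε 0<ε in N , λ n N≤n → N , λ m N≤m →
    ℚ.≤-trans (ℚ.≤-reflexive (cong (λ l → ℚ.∣ seq (t n) m ℚ.- l ∣) (L≡ m))) (close-N n m m N≤n N≤m N≤m)

-- Lambert series

-- A witness of ∣x∣ < 1 by one rational ratio valid at all large indices, as the uniform estimates
-- require.
record Contracting (x : ℝ) : Set where
  constructor contracting
  field
    ratio   : ℚ
    ratio≥0 : 0ℚ ℚ.≤ ratio
    ratio<1 : ratio ℚ.< 1ℚ
    index   : ℕ
    ∣x∣≤    : ∀ m → index ℕ.≤ m → ℚ.∣ seq x m ∣ ℚ.≤ ratio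

Contracting-^ : ∀ {x} → Contracting x → ∀ n .{{_ : NonZero n}} → Contracting (x ^ n)
Contracting-^ {x} (contracting ρ 0≤ρ ρ<1 M x≤ρ) (suc n) = contracting ρ 0≤ρ ρ<1 M λ m M≤m → ℚ.≤-trans
  (ℚ.≤-reflexive (cong ℚ.∣_∣ (seq-^ x (suc n) m)))
  (ℚ.≤-trans (∣x∣≤ρ⇒∣x^n∣≤ρ^n (seq x m) (x≤ρ m M≤m) (suc n)) (ρ^1+n≤ρ n))
  where
  1/1-ρ = 1/₊ (1ℚ ℚ.- ρ) (p<q⇒0<q-p ρ<1)
  open GeometricBounds ρ (proj₁ 1/1-ρ) 0≤ρ ρ<1 (proj₂ (proj₂ 1/1-ρ)) (proj₁ (proj₂ 1/1-ρ))

Contracting⇒1-x-Away : ∀ {x} → Contracting x → Away (1ℝ - x)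
Contracting⇒1-x-Away {x} (contracting ρ 0≤ρ ρ<1 M x≤ρ) = away (1ℚ ℚ.- ρ) (p<q⇒0<q-p ρ<1) M λ m M≤m →
  ℚ.≤-trans (ℚ.+-monoʳ-≤ 1ℚ (ℚ.neg-antimono-≤ (x≤ρ m M≤m))) (∣p∣-∣q∣≤∣p-q∣ 1ℚ (seq x m))

partialSums : (ℕ → ℝ) → ℕ → ℝ
partialSums t N = sum {N} (λ i → t (toℕ i))

module LambertSeries (y c : ℝ) (y-contracting : Contracting y) where

  open Contracting y-contracting using (index; ∣x∣≤) renaming (ratio to ρ; ratio≥0 to 0≤ρ; ratio<1 to ρ<1)

  σ : ℚ
  σ = proj₁ (1/₊ (1ℚ ℚ.- ρ) (p<q⇒0<q-p ρ<1))

  0<σ : 0ℚ ℚ.< σ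
  0<σ = proj₁ (proj₂ (1/₊ (1ℚ ℚ.- ρ) (p<q⇒0<q-p ρ<1)))

  σ-inverse : (1ℚ ℚ.- ρ) ℚ.* σ ≡ 1ℚ
  σ-inverse = proj₂ (proj₂ (1/₊ (1ℚ ℚ.- ρ) (p<q⇒0<q-p ρ<1)))

  open GeometricBounds ρ σ 0≤ρ ρ<1 σ-inverse 0<σ

  C : ℚ
  C = proj₁ (bounded (seq c) (cauchy c))

  N₀ : ℕ
  N₀ = index ℕ.⊔ proj₁ (proj₂ (proj₂ (bounded (seq c) (cauchy c))))

  y≤ρ : ∀ m → N₀ ℕ.≤ m → ℚ.∣ seq y m ∣ ℚ.≤ ρ
  y≤ρ m N₀≤m = ∣x∣≤ m (ℕ.m⊔n≤o⇒m≤o index _ N₀≤m)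

  c≤C : ∀ m → N₀ ℕ.≤ m → ℚ.∣ seq c m ∣ ℚ.≤ C
  c≤C m N₀≤m = proj₂ (proj₂ (proj₂ (bounded (seq c) (cauchy c)))) m (ℕ.m⊔n≤o⇒n≤o index _ N₀≤m)

  0≤C : 0ℚ ℚ.≤ C
  0≤C = ℚ.<⇒≤ (proj₁ (proj₂ (bounded (seq c) (cauchy c))))

  1-y^#0 : ∀ k .{{_ : NonZero k}} → Away (1ℝ - y ^ k)
  1-y^#0 k = Contracting⇒1-x-Away (Contracting-^ y-contracting k)

  quotient : (k l : ℕ) .{{_ : NonZero k}} → ℝ
  quotient k l = (c * y ^ l) / (1ℝ - y ^ k) [ Away⇒# (1-y^#0 k) ]

  -- Lets a term of a Lucas series be recognised by its defining equation, without manipulating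
  -- fractions.
  quotient-unique : ∀ k l .{{_ : NonZero k}} u → u * (1ℝ - y ^ k) ≃ c * y ^ l → quotient k l ≃ u
  quotient-unique k l u eq = *-cancelˡ (1-y^#0 k) (begin
    (1ℝ - y ^ k) * quotient k l  ≈⟨ ℝR.*-comm _ _ ⟩
    quotient k l * (1ℝ - y ^ k)  ≈⟨ /-* (c * y ^ l) (1ℝ - y ^ k) (Away⇒# (1-y^#0 k)) ⟩
    c * y ^ l                    ≈⟨ eq ⟨
    u * (1ℝ - y ^ k)             ≈⟨ ℝR.*-comm _ _ ⟩
    (1ℝ - y ^ k) * u             ∎)
    where open ≃-Reasoning

  -- Exact at every index from `N₀` on, because ∣1 - yᵏ∣ ≥ 1 - ρ > 0 there. As `N₀` depends on
  -- neither k nor l, the estimates apply to all terms at once.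
  seq-quotient : ∀ k l .{{_ : NonZero k}} m → N₀ ℕ.≤ m →
    seq (quotient k l) m ℚ.* (1ℚ ℚ.- seq y m ℚ^.^ k) ≡ seq c m ℚ.* seq y m ℚ^.^ l
  seq-quotient k@(suc k-1) l m N₀≤m = begin-equality
    seq c m ℚ.* seq (y ^ l) m ℚ.* recip (1ℚ ℚ.- seq (y ^ k) m) ℚ.* (1ℚ ℚ.- seq y m ℚ^.^ k)
      ≡⟨ cong₂ (λ p q → seq c m ℚ.* p ℚ.* recip (1ℚ ℚ.- q) ℚ.* (1ℚ ℚ.- seq y m ℚ^.^ k)) (seq-^ y l m) (seq-^ y k m) ⟩
    seq c m ℚ.* seq y m ℚ^.^ l ℚ.* recip (1ℚ ℚ.- seq y m ℚ^.^ k) ℚ.* (1ℚ ℚ.- seq y m ℚ^.^ k)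
      ≡⟨ solve 3 (λ p r z → p :* r :* z := p :* (z :* r)) refl
           (seq c m ℚ.* seq y m ℚ^.^ l) (recip (1ℚ ℚ.- seq y m ℚ^.^ k)) (1ℚ ℚ.- seq y m ℚ^.^ k) ⟩
    seq c m ℚ.* seq y m ℚ^.^ l ℚ.* ((1ℚ ℚ.- seq y m ℚ^.^ k) ℚ.* recip (1ℚ ℚ.- seq y m ℚ^.^ k))
      ≡⟨ cong (seq c m ℚ.* seq y m ℚ^.^ l ℚ.*_) (*-recip (1ℚ ℚ.- seq y m ℚ^.^ k)
           (≤∣p∣⇒≢0 (p<q⇒0<q-p ρ<1) (1-ρ≤∣1-z∣ (seq y m ℚ^.^ k)
             (ℚ.≤-trans (∣x∣≤ρ⇒∣x^n∣≤ρ^n (seq y m) (y≤ρ m N₀≤m) k) (ρ^1+n≤ρ k-1))))) ⟩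
    seq c m ℚ.* seq y m ℚ^.^ l ℚ.* 1ℚ
      ≡⟨ ℚ.*-identityʳ _ ⟩
    seq c m ℚ.* seq y m ℚ^.^ l ∎
    where open ℚ.≤-Reasoning

  s t : ℕ → ℝ
  s n = quotient (suc (2 ℕ.* n)) (suc (2 ℕ.* n))
  t n = quotient (2 ℕ.* suc n) (suc n)

  module At (m : ℕ) (N₀≤m : N₀ ℕ.≤ m) = Lambert (seq y m) (seq c m) C (y≤ρ m N₀≤m) (c≤C m N₀≤m)
    (λ n → seq (s n) m) (λ n → seq (t n) m)
    (λ n → seq-quotient (suc (2 ℕ.* n)) (suc (2 ℕ.* n)) m N₀≤m)
    (λ n → seq-quotient (2 ℕ.* suc n) (suc n) m N₀≤m)

  0≤σC : 0ℚ ℚ.≤ σ ℚ.* C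
  0≤σC = *-nonNeg 0≤σ 0≤C

  s-tail : ∀ {k n m} → N₀ ℕ.≤ m → k ℕ.≤ n →
    ℚ.∣ seq (partialSums s n) m ℚ.- seq (partialSums s k) m ∣ ℚ.≤ σ ℚ.* C ℚ.* σ ℚ.* ρ ℚ^.^ k
  s-tail {k} {n} {m} N₀≤m k≤n = ℚ.≤-trans
    (ℚ.≤-reflexive (cong₂ (λ p q → ℚ.∣ p ℚ.- q ∣) (seq-sum s n m) (seq-sum s k m)))
    (∣partialSum-tail∣≤ (λ i → seq (s i) m) (σ ℚ.* C) 0≤σC (At.∣e∣≤ m N₀≤m) k≤n)

  s-uniformly-cauchy : UniformlyClose (partialSums s) (partialSums s)
  s-uniformly-cauchy ε 0<ε =
    let N₁ , small = Kρ^-null (σ ℚ.* C ℚ.* σ) (*-nonNeg 0≤σC 0≤σ) ε 0<ε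
    in N₀ ℕ.⊔ N₁ , λ n n′ m N≤n N≤n′ N≤m →
      let N₀≤m = ℕ.m⊔n≤o⇒m≤o N₀ N₁ N≤m in
      [ (λ n≤n′ → ℚ.≤-trans (ℚ.≤-reflexive (∣p-q∣≡∣q-p∣ (seq (partialSums s n) m) (seq (partialSums s n′) m)))
          (ℚ.≤-trans (s-tail N₀≤m n≤n′) (small n (ℕ.m⊔n≤o⇒n≤o N₀ N₁ N≤n))))
      , (λ n′≤n → ℚ.≤-trans (s-tail N₀≤m n′≤n) (small n′ (ℕ.m⊔n≤o⇒n≤o N₀ N₁ N≤n′)))
      ]′ (ℕ.≤-total n n′)

  -- The double-sum estimate compares the partial sums of equal length n; the uniform Cauchy
  -- property of s then leads from n to n′.
  t-close-to-s : UniformlyClose (partialSums t) (partialSums s)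
  t-close-to-s ε 0<ε =
    let δ , 0<δ , δ+δ≡ε = half ε 0<ε
        N₁ , s-cauchy = s-uniformly-cauchy δ 0<δ
        N₂ , small = Kρ^-null ((σ ℚ.* C ℚ.+ σ ℚ.* C) ℚ.* σ)
          (*-nonNeg (ℚ.+-mono-≤ {0ℚ} {σ ℚ.* C} {0ℚ} 0≤σC 0≤σC) 0≤σ) δ 0<δ
    in N₀ ℕ.⊔ (N₁ ℕ.⊔ N₂) , λ n n′ m N≤n N≤n′ N≤m →
      let N₁₂≤n = ℕ.m⊔n≤o⇒n≤o N₀ _ N≤n ; N₀≤m = ℕ.m⊔n≤o⇒m≤o N₀ _ N≤m in
      ℚ.≤-trans
        (∣p-r∣≤ (seq (partialSums t n) m) (seq (partialSums s n) m) (seq (partialSums s n′) m)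
          (ℚ.≤-trans
            (ℚ.≤-reflexive (trans (∣p-q∣≡∣q-p∣ (seq (partialSums t n) m) (seq (partialSums s n) m))
              (cong₂ (λ p q → ℚ.∣ p ℚ.- q ∣) (seq-sum s n m) (seq-sum t n m))))
            (ℚ.≤-trans (At.partialSum-difference m N₀≤m n) (small n (ℕ.m⊔n≤o⇒n≤o N₁ N₂ N₁₂≤n))))
          (s-cauchy n n′ m (ℕ.m⊔n≤o⇒m≤o N₁ N₂ N₁₂≤n) (ℕ.m⊔n≤o⇒m≤o N₁ N₂ (ℕ.m⊔n≤o⇒n≤o N₀ _ N≤n′))
            (ℕ.m⊔n≤o⇒m≤o N₁ N₂ (ℕ.m⊔n≤o⇒n≤o N₀ _ N≤m))))
        (ℚ.≤-reflexive δ+δ≡ε)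

  S : ℝ
  S = mkℝ (λ m → seq (partialSums s m) m) (diagonal-cauchy (partialSums s) s-uniformly-cauchy)

  s-sum : HasSum s S
  s-sum = diagonal-limit (partialSums s) (partialSums s) S (λ _ → refl) s-uniformly-cauchy

  t-sum : HasSum t S
  t-sum = diagonal-limit (partialSums s) (partialSums t) S (λ _ → refl) t-close-to-s

-- Lucas sequences

module LucasSequence (P Q α β : ℝ) (U : ℤ → ℝ) (α-root : IsRoot P Q α) (β-root : IsRoot P Q β)
  (∣β∣<∣α∣ : ∣ β ∣ < ∣ α ∣) (lucas : IsLucasSequence P Q U) where

  open IsLucasSequence lucas
  open ≃-Reasoning

  gap≤ : ∀ {ε} n → ℚ.∣ seq β n ∣ ℚ.+ ε ℚ.≤ ℚ.∣ seq α n ∣ → ε ℚ.≤ ℚ.∣ seq α n ∣ ℚ.- ℚ.∣ seq β n ∣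
  gap≤ {ε} n le = ℚ.≤-trans
    (ℚ.≤-reflexive (solve 2 (λ b e → e := b :+ e :- b) refl ℚ.∣ seq β n ∣ ε))
    (ℚ.+-monoˡ-≤ (ℚ.- ℚ.∣ seq β n ∣) le)

  -- The gap between the absolute values also separates the roots, by the reverse triangle
  -- inequality.
  α-β-Away : Away (α - β)
  α-β-Away = let ε , 0<ε , N , gap = ∣β∣<∣α∣ in
    away ε 0<ε N λ n N≤n → ℚ.≤-trans (gap≤ n (gap n N≤n)) (∣p∣-∣q∣≤∣p-q∣ (seq α n) (seq β n))

  α-Away : Away α
  α-Away = let ε , 0<ε , N , gap = ∣β∣<∣α∣ in
    away ε 0<ε N λ n N≤n → ℚ.≤-trans (p≤q+p ε (ℚ.0≤∣p∣ (seq β n))) (gap n N≤n)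

  -- Subtracting the two root equations gives (α - β)(α + β - P) = 0, and α - β cancels.
  α+β≃P : α + β ≃ P
  α+β≃P = *-cancelˡ α-β-Away (begin
    (α - β) * (α + β)
      ≈⟨ pointwise (λ n → solve 4 (λ a b p q → (a :- b) :* (a :+ b)
           := (a :* (a :* con 1ℚ) :- p :* a :+ q) :- (b :* (b :* con 1ℚ) :- p :* b :+ q) :+ (a :- b) :* p)
           refl (seq α n) (seq β n) (seq P n) (seq Q n)) ⟩
    (α ^ 2 - P * α + Q) - (β ^ 2 - P * β + Q) + (α - β) * P
      ≈⟨ ℝR.+-congʳ (+-cong (wrap α-root) (-‿cong (wrap β-root))) ⟩
    0ℝ - 0ℝ + (α - β) * P
      ≈⟨ pointwise (λ n → solve 1 (λ x → con 0ℚ :- con 0ℚ :+ x := x) refl (seq ((α - β) * P) n)) ⟩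
    (α - β) * P ∎)

  Q≃αβ : Q ≃ α * β
  Q≃αβ = begin
    Q
      ≈⟨ pointwise (λ n → solve 3 (λ a p q →
           q := (a :* (a :* con 1ℚ) :- p :* a :+ q) :- a :* a :+ p :* a) refl (seq α n) (seq P n) (seq Q n)) ⟩
    (α ^ 2 - P * α + Q) - α * α + P * α
      ≈⟨ +-cong (ℝR.+-congʳ (wrap α-root)) (ℝR.*-congʳ (ℝR.sym α+β≃P)) ⟩
    0ℝ - α * α + (α + β) * α
      ≈⟨ pointwise (λ n → solve 2 (λ a b → con 0ℚ :- a :* a :+ (a :+ b) :* a := a :* b) refl (seq α n) (seq β n)) ⟩
    α * β ∎

  -- The recurrence has order two, so the induction carries two consecutive indices. Keeping α - β
  -- as a factor avoids a division.
  binet : ∀ n → (α - β) * U (ℤ.+ n) ≃ α ^ n - β ^ n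
  binet n = proj₁ (both n)
    where
    U-step : ∀ n → U (ℤ.+ suc (suc n)) ≃ P * U (ℤ.+ suc n) - Q * U (ℤ.+ n)
    U-step n = wrap (subst₂ (λ k l → U (ℤ.+ k) ≈ P * U (ℤ.+ l) - Q * U (ℤ.+ n))
      (ℕ.+-comm n 2) (ℕ.+-comm n 1) (recurrence (ℤ.+ n)))
    both : ∀ n → (α - β) * U (ℤ.+ n) ≃ α ^ n - β ^ n × (α - β) * U (ℤ.+ suc n) ≃ α ^ suc n - β ^ suc n
    both zero = (begin
      (α - β) * U (ℤ.+ 0)  ≈⟨ ℝR.*-congˡ (wrap U₀) ⟩
      (α - β) * 0ℝ         ≈⟨ pointwise (λ n → solve 2 (λ a b → (a :- b) :* con 0ℚ := con 1ℚ :- con 1ℚ) refl (seq α n) (seq β n)) ⟩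
      1ℝ - 1ℝ              ∎) , (begin
      (α - β) * U (ℤ.+ 1)  ≈⟨ ℝR.*-congˡ (wrap U₁) ⟩
      (α - β) * 1ℝ         ≈⟨ pointwise (λ n → solve 2 (λ a b → (a :- b) :* con 1ℚ := a :* con 1ℚ :- b :* con 1ℚ) refl (seq α n) (seq β n)) ⟩
      α ^ 1 - β ^ 1        ∎)
    both (suc n) = let Bₙ , Bₙ₊₁ = both n in Bₙ₊₁ , (begin
      (α - β) * U (ℤ.+ suc (suc n))
        ≈⟨ ℝR.*-congˡ (U-step n) ⟩
      (α - β) * (P * U (ℤ.+ suc n) - Q * U (ℤ.+ n))
        ≈⟨ pointwise (λ m → solve 5 (λ c p q u v → c :* (p :* u :- q :* v) := p :* (c :* u) :- q :* (c :* v)) refl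
             (seq (α - β) m) (seq P m) (seq Q m) (seq (U (ℤ.+ suc n)) m) (seq (U (ℤ.+ n)) m)) ⟩
      P * ((α - β) * U (ℤ.+ suc n)) - Q * ((α - β) * U (ℤ.+ n))
        ≈⟨ +-cong (*-cong (ℝR.sym α+β≃P) Bₙ₊₁) (-‿cong (*-cong Q≃αβ Bₙ)) ⟩
      (α + β) * (α ^ suc n - β ^ suc n) - α * β * (α ^ n - β ^ n)
        ≈⟨ pointwise (λ m → solve 4 (λ a b x y →
             (a :+ b) :* (a :* x :- b :* y) :- a :* b :* (x :- y) := a :* (a :* x) :- b :* (b :* y)) refl
             (seq α m) (seq β m) (seq (α ^ n) m) (seq (β ^ n) m)) ⟩
      α ^ suc (suc n) - β ^ suc (suc n) ∎)

  x : ℝ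
  x = β / α [ Away⇒# α-Away ]

  xα≃β : x * α ≃ β
  xα≃β = /-* β α (Away⇒# α-Away)

  -- With |α| ≤ B, the gap |β| + ε ≤ |α| gives |β / α| ≤ 1 - ε / B.
  x-contracting : Contracting x
  x-contracting =
    let ε , 0<ε , N₁ , gap = ∣β∣<∣α∣
        B , 0<B , N₂ , α≤B = bounded (seq α) (cauchy α)
        L , 0<L , BL≡1 = 1/₊ B 0<B
        x≤ : ∀ m → N₁ ℕ.⊔ N₂ ℕ.≤ m → ℚ.∣ seq x m ∣ ℚ.≤ 1ℚ ℚ.- L ℚ.* ε
        x≤ = λ m N≤m → ratio-bound (seq α m) (seq β m) 0<ε 0<L BL≡1
          (gap m (ℕ.m⊔n≤o⇒m≤o N₁ N₂ N≤m)) (α≤B m (ℕ.m⊔n≤o⇒n≤o N₁ N₂ N≤m))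
    in contracting (1ℚ ℚ.- L ℚ.* ε)
         -- The ratio is nonnegative because it bounds an absolute value at some index.
         (ℚ.≤-trans (ℚ.0≤∣p∣ (seq x (N₁ ℕ.⊔ N₂))) (x≤ (N₁ ℕ.⊔ N₂) ℕ.≤-refl))
         (p-q<p 1ℚ (*-pos 0<L 0<ε)) (N₁ ℕ.⊔ N₂) x≤
    where
    p-q<p : ∀ p {q} → 0ℚ ℚ.< q → p ℚ.- q ℚ.< p
    p-q<p p 0<q = ℚ.<-≤-trans (ℚ.+-monoʳ-< p (ℚ.neg-antimono-< 0<q)) (ℚ.≤-reflexive (ℚ.+-identityʳ p))
    ratio-bound : ∀ a b {ε B L} → 0ℚ ℚ.< ε → 0ℚ ℚ.< L → B ℚ.* L ≡ 1ℚ →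
      ℚ.∣ b ∣ ℚ.+ ε ℚ.≤ ℚ.∣ a ∣ → ℚ.∣ a ∣ ℚ.≤ B → ℚ.∣ b ℚ.* recip a ∣ ℚ.≤ 1ℚ ℚ.- L ℚ.* ε
    ratio-bound a b {ε} {B} {L} 0<ε 0<L BL≡1 gap a≤B = ℚR.begin
      ℚ.∣ b ℚ.* recip a ∣
        ℚR.≡⟨ ℚ.∣p*q∣≡∣p∣*∣q∣ b (recip a) ⟩
      ℚ.∣ b ∣ ℚ.* r
        ℚR.≡⟨ solve 3 (λ b r e → b :* r := (b :+ e) :* r :- r :* e) refl ℚ.∣ b ∣ r ε ⟩
      (ℚ.∣ b ∣ ℚ.+ ε) ℚ.* r ℚ.- r ℚ.* ε
        ℚR.≤⟨ ℚ.+-mono-≤ (ℚ.*-monoʳ-≤-nonNeg r {{ℚ.∣-∣-nonNeg (recip a)}} gap)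
               (ℚ.neg-antimono-≤ (ℚ.*-monoʳ-≤-nonNeg ε {{ℚ.nonNegative (ℚ.<⇒≤ 0<ε)}} L≤r)) ⟩
      ℚ.∣ a ∣ ℚ.* r ℚ.- L ℚ.* ε
        ℚR.≡⟨ cong (ℚ._- L ℚ.* ε) ∣a∣r≡1 ⟩
      1ℚ ℚ.- L ℚ.* ε ℚR.∎
      where
      module ℚR = ℚ.≤-Reasoning
      r = ℚ.∣ recip a ∣
      ∣a∣r≡1 : ℚ.∣ a ∣ ℚ.* r ≡ 1ℚ
      ∣a∣r≡1 = trans (sym (ℚ.∣p*q∣≡∣p∣*∣q∣ a (recip a)))
        (cong ℚ.∣_∣ (*-recip a (≤∣p∣⇒≢0 0<ε (ℚ.≤-trans (p≤q+p ε (ℚ.0≤∣p∣ b)) gap))))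
      L≤r : L ℚ.≤ r
      L≤r = ℚ.≤-trans (ℚ.≤-reflexive (sym (ℚ.*-identityʳ L)))
        (≤B*q⇒L*≤q {B} {L} {1ℚ} {r} 0<L BL≡1 (ℚ.≤-trans (ℚ.≤-reflexive (sym ∣a∣r≡1))
          (ℚ.*-monoʳ-≤-nonNeg r {{ℚ.∣-∣-nonNeg (recip a)}} a≤B)))

  β^≃α^x^ : ∀ n → β ^ n ≃ α ^ n * x ^ n
  β^≃α^x^ n = begin
    β ^ n          ≈⟨ ^-congˡ n (ℝR.trans (ℝR.sym xα≃β) (ℝR.*-comm x α)) ⟩
    (α * x) ^ n    ≈⟨ ^-distrib-* α x n ⟩
    α ^ n * x ^ n  ∎

  -- Q = αβ = α² x. The power of α matches the one in Binet's formula at the doubled index n + n.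
  Q^≃α^x^ : ∀ n → Q ^ n ≃ α ^ (n ℕ.+ n) * x ^ n
  Q^≃α^x^ n = begin
    Q ^ n                      ≈⟨ ^-congˡ n Q≃αβ ⟩
    (α * β) ^ n                ≈⟨ ^-distrib-* α β n ⟩
    α ^ n * β ^ n              ≈⟨ ℝR.*-congˡ (β^≃α^x^ n) ⟩
    α ^ n * (α ^ n * x ^ n)    ≈⟨ ℝR.*-assoc (α ^ n) (α ^ n) (x ^ n) ⟨
    α ^ n * α ^ n * x ^ n      ≈⟨ ℝR.*-congʳ (^-homo-* α n n) ⟨
    α ^ (n ℕ.+ n) * x ^ n      ∎

  binet-x : ∀ n → (α - β) * U (ℤ.+ n) ≃ α ^ n * (1ℝ - x ^ n)
  binet-x n = begin
    (α - β) * U (ℤ.+ n)       ≈⟨ binet n ⟩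
    α ^ n - β ^ n             ≈⟨ ℝR.+-congˡ (-‿cong (β^≃α^x^ n)) ⟩
    α ^ n - α ^ n * x ^ n
      ≈⟨ pointwise (λ m → solve 2 (λ a x → a :- a :* x := a :* (con 1ℚ :- x)) refl (seq (α ^ n) m) (seq (x ^ n) m)) ⟩
    α ^ n * (1ℝ - x ^ n)      ∎

  -- By `binet-x`, (α - β) Uₙ is a product of two reals bounded away from 0.
  U#0 : ∀ n .{{_ : NonZero n}} → U (ℤ.+ n) # 0ℝ
  U#0 n = Away⇒# (Away-*⁻ʳ (Away-resp-≃ (ℝR.sym (binet-x n))
    (Away-* (Away-^ α-Away n) (Contracting⇒1-x-Away (Contracting-^ x-contracting n)))))

  -- Multiplied by αᵏ, the left side becomes (α - β) q by Binet's formula. The first series uses q =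
  -- βᵏ and z = xᵏ, the second q = Qʲ and z = xʲ with k = 2j.
  term-equation : ∀ k {q z} (U#0 : U (ℤ.+ k) # 0ℝ) → q ≃ α ^ k * z →
    q / U (ℤ.+ k) [ U#0 ] * (1ℝ - x ^ k) ≃ (α - β) * z
  term-equation k {q} {z} U#0 q≃ = *-cancelˡ (Away-^ α-Away k) (begin
    α ^ k * (u * (1ℝ - x ^ k))    ≈⟨ swap (α ^ k) u (1ℝ - x ^ k) ⟩
    u * (α ^ k * (1ℝ - x ^ k))    ≈⟨ ℝR.*-congˡ (binet-x k) ⟨
    u * ((α - β) * U (ℤ.+ k))     ≈⟨ swap u (α - β) (U (ℤ.+ k)) ⟩
    (α - β) * (u * U (ℤ.+ k))     ≈⟨ ℝR.*-congˡ (/-* q (U (ℤ.+ k)) U#0) ⟩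
    (α - β) * q                   ≈⟨ ℝR.*-congˡ q≃ ⟩
    (α - β) * (α ^ k * z)         ≈⟨ swap (α - β) (α ^ k) z ⟩
    α ^ k * ((α - β) * z)         ∎)
    where
    u = q / U (ℤ.+ k) [ U#0 ]
    swap : ∀ a b c → a * (b * c) ≃ b * (a * c)
    swap a b c = pointwise λ n →
      solve 3 (λ a b c → a :* (b :* c) := b :* (a :* c)) refl (seq a n) (seq b n) (seq c n)

theorem3p6 : ∀ (P Q α β : ℝ) (U : ℤ → ℝ) →
    P ≉ 0ℝ → Q ≉ 0ℝ → 0ℝ < P ^ 2 - 4ℝ * Q →
    IsRoot P Q α → IsRoot P Q β → ∣ β ∣ < ∣ α ∣ →
    IsLucasSequence P Q U →
    ∀ (r : ℕ) .{{_ : NonZero r}} →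
    Σ[ U#0  ∈ (∀ n → U (ℤ.+ (2 ℕ.^ r ℕ.* n ℕ.+ 2 ℕ.^ pred r)) # 0ℝ) ]
    Σ[ U#0′ ∈ (∀ n .{{_ : NonZero n}} → U (ℤ.+ (2 ℕ.^ r ℕ.* n)) # 0ℝ) ]
    ∃[ S ]
    HasSum (λ n → β ^ (2 ℕ.^ r ℕ.* n ℕ.+ 2 ℕ.^ pred r) / U (ℤ.+ (2 ℕ.^ r ℕ.* n ℕ.+ 2 ℕ.^ pred r)) [ U#0 n ]) S
    × HasSum (λ n → Q ^ (2 ℕ.^ pred r ℕ.* suc n) / U (ℤ.+ (2 ℕ.^ r ℕ.* suc n)) [ U#0′ (suc n) ]) S
theorem3p6 P Q α β U _ _ _ α-root β-root ∣β∣<∣α∣ lucas (suc r-1) =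
  U#0-odd , U#0-even , S ,
  HasSum-resp-≃ {s} {λ n → β ^ k n / U (ℤ.+ k n) [ U#0-odd n ]} {S} s≃ s-sum ,
  HasSum-resp-≃ {t} {λ n → Q ^ j n / U (ℤ.+ l n) [ U#0-even (suc n) ]} {S} t≃ t-sum
  where
  open LucasSequence P Q α β U α-root β-root ∣β∣<∣α∣ lucas
  open ≃-Reasoning
  -- Since r is `suc r-1`, `2 ^ pred r` is `d` and `2 ^ r` computes to `2 * d`.
  d = 2 ℕ.^ r-1
  instance
    d≢0 : NonZero d
    d≢0 = ℕ.m^n≢0 2 r-1
  k j l : ℕ → ℕ
  k n = 2 ℕ.* d ℕ.* n ℕ.+ d
  j n = d ℕ.* suc n
  l n = 2 ℕ.* d ℕ.* suc n
  -- As k n = d (2n + 1), l n = d (2 (n + 1)) and j n = d (n + 1), every power of x that occurs is a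
  -- power of y = x^d.
  open LambertSeries (x ^ d) (α - β) (Contracting-^ x-contracting d)
  U#0-odd : ∀ n → U (ℤ.+ k n) # 0ℝ
  U#0-odd n = U#0 (k n) {{ℕ.>-nonZero (ℕ.<-≤-trans (ℕ.>-nonZero⁻¹ d) (ℕ.m≤n+m d (2 ℕ.* d ℕ.* n)))}}
  U#0-even : ∀ n .{{_ : NonZero n}} → U (ℤ.+ (2 ℕ.* d ℕ.* n)) # 0ℝ
  U#0-even n = U#0 (2 ℕ.* d ℕ.* n) {{ℕ.m*n≢0 (2 ℕ.* d) n {{ℕ.m*n≢0 2 d}}}}
  y^≃ : ∀ m {i} → d ℕ.* m ≡ i → (x ^ d) ^ m ≃ x ^ i
  y^≃ m eq = ℝR.trans (^-assocʳ x d m) (ℝR.reflexive (cong (x ^_) eq))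
  y^odd : ∀ n → (x ^ d) ^ suc (2 ℕ.* n) ≃ x ^ k n
  y^odd n = y^≃ (suc (2 ℕ.* n)) (ℕ-Solver.solve 2 (λ d n →
    d ℕ-Solver.:* (ℕ-Solver.con 1 ℕ-Solver.:+ ℕ-Solver.con 2 ℕ-Solver.:* n)
      ℕ-Solver.:= ℕ-Solver.con 2 ℕ-Solver.:* d ℕ-Solver.:* n ℕ-Solver.:+ d) refl d n)
  s≃ : ∀ n → s n ≃ β ^ k n / U (ℤ.+ k n) [ U#0-odd n ]
  s≃ n = quotient-unique (suc (2 ℕ.* n)) (suc (2 ℕ.* n)) _ (begin
    u * (1ℝ - (x ^ d) ^ suc (2 ℕ.* n))    ≈⟨ ℝR.*-congˡ (ℝR.+-congˡ (-‿cong (y^odd n))) ⟩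
    u * (1ℝ - x ^ k n)                    ≈⟨ term-equation (k n) (U#0-odd n) (β^≃α^x^ (k n)) ⟩
    (α - β) * x ^ k n                     ≈⟨ ℝR.*-congˡ (y^odd n) ⟨
    (α - β) * (x ^ d) ^ suc (2 ℕ.* n)     ∎)
    where u = β ^ k n / U (ℤ.+ k n) [ U#0-odd n ]
  t≃ : ∀ n → t n ≃ Q ^ j n / U (ℤ.+ l n) [ U#0-even (suc n) ]
  t≃ n = quotient-unique (2 ℕ.* suc n) (suc n) _ (begin
    u * (1ℝ - (x ^ d) ^ (2 ℕ.* suc n))    ≈⟨ ℝR.*-congˡ (ℝR.+-congˡ (-‿cong (y^≃ (2 ℕ.* suc n) d2n≡l))) ⟩
    u * (1ℝ - x ^ l n)                    ≈⟨ term-equation (l n) (U#0-even (suc n)) Q^≃α^l ⟩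
    (α - β) * x ^ j n                     ≈⟨ ℝR.*-congˡ (y^≃ (suc n) refl) ⟨
    (α - β) * (x ^ d) ^ suc n             ∎)
    where
    u = Q ^ j n / U (ℤ.+ l n) [ U#0-even (suc n) ]
    d2n≡l : d ℕ.* (2 ℕ.* suc n) ≡ l n
    d2n≡l = trans (sym (ℕ.*-assoc d 2 (suc n))) (cong (ℕ._* suc n) (ℕ.*-comm d 2))
    j+j≡l : j n ℕ.+ j n ≡ l n
    j+j≡l = ℕ-Solver.solve 2 (λ d m → d ℕ-Solver.:* m ℕ-Solver.:+ d ℕ-Solver.:* m
      ℕ-Solver.:= ℕ-Solver.con 2 ℕ-Solver.:* d ℕ-Solver.:* m) refl d (suc n)
    Q^≃α^l : Q ^ j n ≃ α ^ l n * x ^ j n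
    Q^≃α^l = ℝR.trans (Q^≃α^x^ (j n)) (ℝR.*-congʳ (ℝR.reflexive (cong (α ^_) j+j≡l)))
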